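{- Let $m\ge 2$ be an integer and $n$ an even positive integer. A cyclic $\ell$-cycle system of $K_{m\times n}$ does not exist in each of the following cases: (a) $m\equiv 0\pmod 4$ and $|\ell|_2=|m|_2+2|n|_2-1$; (b) $m\equiv 1\pmod 4$ and $|\ell|_2=|m-1|_2+2|n|_2-1$; (c) $m\equiv 2,3\pmod 4$, $n\equiv 2\pmod 4$ and $\ell\not\equiv 0\pmod 4$; (d) $m\equiv 2,3\pmod 4$, $n\equiv 0\pmod 4$ and $|\ell|_2=2|n|_2$.
   Context: $K_{m\times n}$ is the complete multipartite graph with $m$ parts of size $n$, with vertex set identified with $\mathbb{Z}_{mn}$, parts the cosets of $m\mathbb{Z}_{mn}$, and $x,y$ adjacent iff $x-y\notin m\mathbb{Z}_{mn}$. An $\ell$-cycle system is a set of cycles of length $\ell$ whose edge sets partition the edge set; it is cyclic if whenever $(c_0,\dots,c_{\ell-1})$ belongs to it, so does $(c_0+1,\dots,c_{\ell-1}+1)$. For a positive integer $x$, $|x|_2$ denotes the largest $e$ such that $2^e$ divides $x$. -}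

module Defs where

open import Data.Nat using (ℕ; zero; suc; _+_; _*_; _∸_; _^_; _≤_; _<_; _≡ᵇ_; ∣_-_∣)
open import Data.Nat.Divisibility using (_∣_)
open import Data.Bool using (Bool; true; false; if_then_else_; _∧_; _∨_)
open import Data.List using (List; []; _∷_; length; map; zip; drop; take; _++_; reverse)
open import Data.Nat.ListAction using (sum)
open import Data.List.Relation.Unary.All using (All)
open import Data.List.Relation.Unary.Unique.Propositional using (Unique)
open import Data.List.Membership.Propositional using (_∈_)
open import Data.Product using (_×_; _,_; ∃; Σ)
open import Data.Sum using (_⊎_)
open import Relation.Nullary using (¬_)
open import Relation.Binary.PropositionalEquality using (_≡_)

-- 2-adic valuation as a relation:  Val2 x e  means  |x|_2 = e
-- (2^e divides x and 2^(e+1) does not; only satisfiable for x > 0).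
Val2 : ℕ → ℕ → Set
Val2 x e = (2 ^ e ∣ x) × ¬ (2 ^ suc e ∣ x)

-- Vertices of K_{m×n} are 0,…,mn-1 (= ℤ_{mn}); x,y adjacent iff x - y ∉ mℤ_{mn},
-- i.e. m does not divide |x - y| (since m ∣ mn).
Adj : ℕ → ℕ → ℕ → Set
Adj m x y = ¬ (m ∣ ∣ x - y ∣)

rotate : ℕ → List ℕ → List ℕ
rotate k c = drop k c ++ take k c

edges : List ℕ → List (ℕ × ℕ)
edges c = zip c (rotate 1 c)

IsCycle : ℕ → ℕ → ℕ → List ℕ → Set
IsCycle m n ℓ c =
  (length c ≡ ℓ) × (3 ≤ ℓ) × All (λ v → v < m * n) c × Unique c
  × All (λ e → Adj m (Data.Product.proj₁ e) (Data.Product.proj₂ e)) (edges c)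

matches : ℕ → ℕ → ℕ × ℕ → Bool
matches x y (a , b) = ((a ≡ᵇ x) ∧ (b ≡ᵇ y)) ∨ ((a ≡ᵇ y) ∧ (b ≡ᵇ x))

countIn : ℕ → ℕ → List (ℕ × ℕ) → ℕ
countIn x y [] = 0
countIn x y (e ∷ es) = (if matches x y e then 1 else 0) + countIn x y es

edgeCount : ℕ → ℕ → List (List ℕ) → ℕ
edgeCount x y S = sum (map (λ c → countIn x y (edges c)) S)

SameCycle : List ℕ → List ℕ → Set
SameCycle c d = ∃ λ k → (d ≡ rotate k c) ⊎ (d ≡ rotate k (reverse c))

-- x ↦ x + 1 in ℤ_N (for x < N)
succMod : ℕ → ℕ → ℕ
succMod N x = if suc x ≡ᵇ N then 0 else suc x

shift : ℕ → List ℕ → List ℕ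
shift N c = map (succMod N) c

IsCycleSystem : ℕ → ℕ → ℕ → List (List ℕ) → Set
IsCycleSystem m n ℓ S =
  All (IsCycle m n ℓ) S
  × (∀ x y → x < m * n → y < m * n → Adj m x y → edgeCount x y S ≡ 1)

IsCyclicCycleSystem : ℕ → ℕ → ℕ → List (List ℕ) → Set
IsCyclicCycleSystem m n ℓ S =
  IsCycleSystem m n ℓ S
  × (∀ c → c ∈ S → ∃ λ d → (d ∈ S) × SameCycle (shift (m * n) c) d)

CyclicCycleSystemExists : ℕ → ℕ → ℕ → Set
CyclicCycleSystemExists m n ℓ = ∃ λ S → IsCyclicCycleSystem m n ℓ S

{-# OPTIONS --safe #-}
module Submission where

-- Write N = mn and n = 2h.  Call an edge odd if its ends have different parity, and let o(C) be
-- the number of odd edges of a cycle C.  A translation that fixes C rotates it (a reflection would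
-- fix a vertex, or reverse an edge of difference N/2, a multiple of m).  Say translation by p
-- rotates C by r places, where p is the size of the orbit of C and N = dp.  Then dr = wℓ, and
-- counting odd edges along this walk gives w·o(C) = d·o_r, where o_r, the number of odd edges
-- among r consecutive ones, is congruent to p modulo 2; moreover w is odd if d is even.  Hence,
-- with 2^e the largest power of 2 dividing N, the orbit sum p·(o(C) + N) is divisible by 2^(e+1).
-- Summing over the orbits of a system S, and using that K_{m×n} has N·h⌊m/2⌋ odd edges, gives
-- |S| ≡ h⌊m/2⌋ (mod 2).  Together with 2|S|ℓ = n²m(m-1) this contradicts each of the four cases.

open import Defs
open import Algebra.Properties.CommutativeSemigroup using (interchange)
open import Data.Bool using (Bool; true; false; if_then_else_; T; _∧_)
open import Data.Bool.Properties using (∨-zeroʳ)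
open import Data.Empty using (⊥; ⊥-elim)
open import Data.Fin using (Fin; zero; suc)
import Data.Fin.Properties as Fin
open import Data.List using (List; []; _∷_; _++_; map; length; lookup; allFin; drop; take; reverse; zip; applyUpTo)
open import Data.List.Properties
  using (map-++; map-cong; map-∘; map-tabulate; tabulate-lookup; unfold-reverse; drop-all; take-all; length-++; length-map; length-drop; length-take; length-reverse; length-applyUpTo; length-tabulate)
open import Data.List.Membership.Propositional using (_∈_; _∉_)
open import Data.List.Membership.Propositional.Properties
  using (∈-∃++; ∈-++⁻; ∈-++⁺ʳ; ∈-applyUpTo⁺; ∈-applyUpTo⁻; ∈-allFin; ∈-lookup)
open import Data.List.Relation.Binary.Permutation.Propositional
  using (_↭_; ↭-refl; ↭-sym; ↭-trans; ↭⇒↭ₛ; prep)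
open import Data.List.Relation.Binary.Permutation.Propositional.Properties
  using (∈-resp-↭; ↭-length; map⁺) renaming (shift to ↭-shift)
open import Data.List.Relation.Binary.Permutation.Setoid.Properties using (Unique-resp-↭)
open import Data.List.Relation.Unary.All using (All)
import Data.List.Relation.Unary.All as All
import Data.List.Relation.Unary.All.Properties as All
import Data.List.Relation.Unary.AllPairs as AllPairs
open import Data.List.Relation.Unary.Any using (here; there; index)
open import Data.List.Relation.Unary.Any.Properties using (lookup-index)
open import Data.List.Relation.Unary.Unique.Propositional using (Unique)
import Data.List.Relation.Unary.Unique.Propositional.Properties as Unique
open import Data.Nat
open import Data.Nat.DivMod
open import Data.Nat.Divisibility
open import Data.Nat.ListAction using (sum)
open import Data.Nat.ListAction.Properties using (sum-++; sum-↭)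
open import Data.Nat.Properties
open import Data.Nat.Tactic.RingSolver using (solve)
open import Data.Product using (∃; ∃₂; _×_; _,_; proj₁; proj₂)
open import Data.Sum using (_⊎_; inj₁; inj₂)
open import Function using (_∘_; id)
open import Relation.Binary.Definitions using (DecidableEquality)
open import Relation.Binary.PropositionalEquality using (_≡_; _≢_; refl; sym; trans; cong; cong₂; subst; subst₂; setoid; module ≡-Reasoning)
open import Relation.Nullary using (¬_; yes; no)
open import Relation.Nullary.Decidable using (decidable-stable)
open import Relation.Unary using (Decidable)
open ≡-Reasoning

-- The obstacle is an orbit shorter than N: when d = N/p is even, p has fewer factors 2 than N, and
-- nothing but evenness is evident about o(C). Only a combination of the two can be controlled, and
-- o(C) + N is the one that adds up well: the p cycles of each orbit contribute p·N, so the sum over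
-- S is N·h⌊m/2⌋ + N·|S|, in which N is a common factor. One factor 2 more than N has is then
-- exactly the parity of h⌊m/2⌋ + |S|.
--
-- The number N·h⌊m/2⌋ comes from a single vertex: hm vertices have the opposite parity, and h(m mod
-- 2) of them lie in its own part, which leaves 2h⌊m/2⌋ odd edges at each vertex.
--
-- In cases (a), (b) and (d) the number h⌊m/2⌋ is even, so |S| is even and 2|S|ℓ has at least one
-- factor 2 more than n²m(m-1). In case (c) it is odd, so |S| is odd and the factor 4 of |S|ℓ has to
-- come from ℓ.

-- Congruences of natural numbers

-- Multiples of `M` on both sides replace an integer difference, so congruences are stated and
-- composed without subtraction.
record Cong (M a b : ℕ) : Set where
  constructor offset
  field
    u v : ℕ
    agree : a + u * M ≡ b + v * M

cong-refl : ∀ {M a b} → a ≡ b → Cong M a b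
cong-refl refl = offset 0 0 refl

cong-sym : ∀ {M a b} → Cong M a b → Cong M b a
cong-sym (offset u v e) = offset v u (sym e)

cong-trans : ∀ {M a b c} → Cong M a b → Cong M b c → Cong M a c
cong-trans {M} {a} {b} {c} (offset u v e) (offset u′ v′ e′) = offset (u + u′) (v′ + v) (begin
  a + (u + u′) * M       ≡⟨ solve (a ∷ u ∷ u′ ∷ M ∷ []) ⟩
  (a + u * M) + u′ * M   ≡⟨ cong (_+ u′ * M) e ⟩
  (b + v * M) + u′ * M   ≡⟨ solve (b ∷ v ∷ u′ ∷ M ∷ []) ⟩
  (b + u′ * M) + v * M   ≡⟨ cong (_+ v * M) e′ ⟩
  (c + v′ * M) + v * M   ≡⟨ solve (c ∷ v ∷ v′ ∷ M ∷ []) ⟩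
  c + (v′ + v) * M       ∎)

cong-+ : ∀ {M a b c d} → Cong M a b → Cong M c d → Cong M (a + c) (b + d)
cong-+ {M} {a} {b} {c} {d} (offset u v e) (offset u′ v′ e′) = offset (u + u′) (v + v′) (begin
  a + c + (u + u′) * M         ≡⟨ solve (a ∷ c ∷ u ∷ u′ ∷ M ∷ []) ⟩
  (a + u * M) + (c + u′ * M)   ≡⟨ cong₂ _+_ e e′ ⟩
  (b + v * M) + (d + v′ * M)   ≡⟨ solve (b ∷ d ∷ v ∷ v′ ∷ M ∷ []) ⟩
  b + d + (v + v′) * M         ∎)

cong-+-cancelˡ : ∀ {M a b} c → Cong M (c + a) (c + b) → Cong M a b
cong-+-cancelˡ {M} {a} {b} c (offset u v e) = offset u v
  (+-cancelˡ-≡ c _ _ (trans (sym (+-assoc c a _)) (trans e (+-assoc c b _))))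

cong-∣ : ∀ {K M a b} → K ∣ M → Cong M a b → Cong K a b
cong-∣ {K} {_} {a} {b} (divides q refl) (offset u v e) =
  offset (u * q) (v * q) (trans (cong (a +_) (*-assoc u q K)) (trans e (cong (b +_) (sym (*-assoc v q K)))))

cong⇒% : ∀ {M a b} .{{_ : NonZero M}} → Cong M a b → a % M ≡ b % M
cong⇒% {M} {a} {b} (offset u v e) =
  trans (sym ([m+kn]%n≡m%n a u M)) (trans (cong (_% M) e) ([m+kn]%n≡m%n b v M))

%-cong : ∀ {M} a .{{_ : NonZero M}} → Cong M a (a % M)
%-cong {M} a = offset 0 (a / M) (trans (+-identityʳ a) (m≡m%n+[m/n]*n a M))

%⇒cong : ∀ {M a b} .{{_ : NonZero M}} → a % M ≡ b % M → Cong M a b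
%⇒cong {a = a} {b} e = cong-trans (%-cong a) (cong-trans (cong-refl e) (cong-sym (%-cong b)))

cong⇒≡ : ∀ {M a b} → a < M → b < M → Cong M a b → a ≡ b
cong⇒≡ {suc M} a<M b<M e = trans (sym (m<n⇒m%n≡m a<M)) (trans (cong⇒% e) (m<n⇒m%n≡m b<M))

∣⇒cong0 : ∀ {M a} → M ∣ a → Cong M a 0
∣⇒cong0 {a = a} (divides q refl) = offset 0 q (+-identityʳ a)

cong0⇒∣ : ∀ {M a} → Cong M a 0 → M ∣ a
cong0⇒∣ {M} {a} (offset u v e) = ∣m+n∣m⇒∣n
  (divides v (trans (+-comm (u * M) a) e)) (n∣m*n u)

cong⇒∣∣-∣ : ∀ {M} x y → Cong M x y → M ∣ ∣ x - y ∣
cong⇒∣∣-∣ {M} zero y e = cong0⇒∣ (cong-sym e)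
cong⇒∣∣-∣ {M} (suc x) zero e = cong0⇒∣ e
cong⇒∣∣-∣ {M} (suc x) (suc y) e = cong⇒∣∣-∣ x y (cong-+-cancelˡ 1 e)

∣∣-∣⇒cong : ∀ {M} x y → M ∣ ∣ x - y ∣ → Cong M x y
∣∣-∣⇒cong {M} zero y e = cong-sym (∣⇒cong0 e)
∣∣-∣⇒cong {M} (suc x) zero e = ∣⇒cong0 e
∣∣-∣⇒cong {M} (suc x) (suc y) e = cong-+ (cong-refl {a = 1} refl) (∣∣-∣⇒cong x y e)

-- Finite sums and parity

∑ : ℕ → (ℕ → ℕ) → ℕ
∑ zero    f = 0
∑ (suc n) f = f 0 + ∑ n (f ∘ suc)

∑-cong : ∀ n {f g : ℕ → ℕ} → (∀ k → k < n → f k ≡ g k) → ∑ n f ≡ ∑ n g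
∑-cong zero    e = refl
∑-cong (suc n) e = cong₂ _+_ (e 0 z<s) (∑-cong n λ k k<n → e (suc k) (s<s k<n))

∑-const : ∀ n a → ∑ n (λ _ → a) ≡ n * a
∑-const zero    a = refl
∑-const (suc n) a = cong (a +_) (∑-const n a)

∑-+ : ∀ n (f g : ℕ → ℕ) → ∑ n (λ k → f k + g k) ≡ ∑ n f + ∑ n g
∑-+ zero    f g = refl
∑-+ (suc n) f g = trans (cong (f 0 + g 0 +_) (∑-+ n (f ∘ suc) (g ∘ suc)))
  (interchange +-commutativeSemigroup (f 0) (g 0) (∑ n (f ∘ suc)) (∑ n (g ∘ suc)))

∑-*ˡ : ∀ n a (f : ℕ → ℕ) → ∑ n (λ k → a * f k) ≡ a * ∑ n f
∑-*ˡ zero    a f = sym (*-zeroʳ a)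
∑-*ˡ (suc n) a f = trans (cong (a * f 0 +_) (∑-*ˡ n a (f ∘ suc))) (sym (*-distribˡ-+ a (f 0) _))

∑-++ : ∀ a b (f : ℕ → ℕ) → ∑ (a + b) f ≡ ∑ a f + ∑ b (λ k → f (a + k))
∑-++ zero    b f = refl
∑-++ (suc a) b f = trans (cong (f 0 +_) (∑-++ a b (f ∘ suc))) (sym (+-assoc (f 0) _ _))

∑-periodic : ∀ q p (f : ℕ → ℕ) → (∀ k → f (p + k) ≡ f k) → ∑ (q * p) f ≡ q * ∑ p f
∑-periodic zero    p f e = refl
∑-periodic (suc q) p f e = trans (∑-++ p (q * p) f)
  (cong (∑ p f +_) (trans (∑-cong (q * p) λ k _ → e k) (∑-periodic q p f e)))

δ : ℕ → ℕ → ℕ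
δ a x = if a ≡ᵇ x then 1 else 0

δ-refl : ∀ a → δ a a ≡ 1
δ-refl zero    = refl
δ-refl (suc a) = δ-refl a

δ-≢ : ∀ {a b} → a ≢ b → δ a b ≡ 0
δ-≢ {a} {b} a≢b with a ≡ᵇ b in eq
... | false = refl
... | true  = ⊥-elim (a≢b (≡ᵇ⇒≡ a b (subst T (sym eq) _)))

∑-δ : ∀ n a (f : ℕ → ℕ) → a < n → ∑ n (λ x → δ a x * f x) ≡ f a
∑-δ (suc n) zero    f _         =
  trans (cong₂ _+_ (*-identityˡ (f 0)) (trans (∑-const n 0) (*-zeroʳ n))) (+-identityʳ _)
∑-δ (suc n) (suc a) f (s<s a<n) = ∑-δ n a (f ∘ suc) a<n

par : ℕ → ℕ
par z = z % 2

par-≤1 : ∀ z → par z ≡ 0 ⊎ par z ≡ 1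
par-≤1 z with z % 2 | m%n<n z 2
... | 0 | _ = inj₁ refl
... | 1 | _ = inj₂ refl
... | suc (suc _) | s≤s (s≤s ())

par-+ : ∀ a b → par (a + b) ≡ par (par a + par b)
par-+ a b = %-distribˡ-+ a b 2

par-* : ∀ a b → par (a * b) ≡ par (par a * par b)
par-* a b = %-distribˡ-* a b 2

par-drop : ∀ a b q → a ≡ b + q * 2 → par a ≡ par b
par-drop a b q e = trans (cong par e) ([m+kn]%n≡m%n b q 2)

-- Odd edges at a vertex of the complete multipartite graph

module _ (m : ℕ) .{{_ : NonZero m}} where

  -- `ν` indicates that two vertices lie in the same part; `χ` is the adjacency matrix of the graph.
  ν χ : ℕ → ℕ → ℕ
  ν x y = δ (x % m) (y % m)
  χ x y = 1 ∸ ν x y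

  χ-Adj : ∀ x y → Adj m x y → χ x y ≡ 1
  χ-Adj x y adj = cong (1 ∸_) (δ-≢ λ e → adj (cong⇒∣∣-∣ x y (%⇒cong e)))

  χ-¬Adj : ∀ x y → ¬ Adj m x y → χ x y ≡ 0
  χ-¬Adj x y ¬adj = cong (1 ∸_) (trans
    (cong (δ (x % m)) (sym (cong⇒% (∣∣-∣⇒cong x y (decidable-stable (m ∣? ∣ x - y ∣) ¬adj)))))
    (δ-refl (x % m)))

  χ+ν : ∀ x y → χ x y + ν x y ≡ 1
  χ+ν x y with x % m ≡ᵇ y % m
  ... | true  = refl
  ... | false = refl

  χ-sym : ∀ x y → χ x y ≡ χ y x
  χ-sym x y with x % m ≟ y % m
  ... | yes e rewrite e = refl
  ... | no ne rewrite δ-≢ ne | δ-≢ (ne ∘ sym) = refl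

  ν-+m : ∀ x y → ν x (m + y) ≡ ν x y
  ν-+m x y = cong (δ (x % m)) (trans (cong (_% m) (+-comm m y)) ([m+n]%n≡m%n y m))

  ∑-ν-block : ∀ x (f : ℕ → ℕ) → ∑ m (λ y → ν x y * f y) ≡ f (x % m)
  ∑-ν-block x f = trans
    (∑-cong m λ y y<m → cong (λ z → δ (x % m) z * f y) (m<n⇒m%n≡m y<m))
    (∑-δ m (x % m) f (m%n<n x m))

  -- Of the two residues modulo 2m in the class of x modulo m, the one opposite in parity to x
  -- exists only for odd m.
  par-pair : ∀ x → par (x + x % m) + par (x + (m + x % m)) ≡ par m
  par-pair x = trans (cong₂ (λ u v → par (u + x % m) + par (v + (m + x % m))) x≡ x≡)
    (main (x % m) (x / m))
    where
    x≡ = m≡m%n+[m/n]*n x m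
    red : ∀ q r → par (r + q * m + r) ≡ par (q * m)
    red q r = par-drop (r + q * m + r) (q * m) r (solve (r ∷ q ∷ m ∷ []))
    red′ : ∀ q r → par (r + q * m + (m + r)) ≡ par (q * m + m)
    red′ q r = par-drop (r + q * m + (m + r)) (q * m + m) r (solve (r ∷ q ∷ m ∷ []))
    fin : ∀ q → par (q * m) + par (q * m + m) ≡ par m
    fin q with par-≤1 m
    ... | inj₁ e rewrite par-+ (q * m) m | par-* q m | e | *-zeroʳ (q % 2) = refl
    ... | inj₂ e with par-≤1 q
    ...   | inj₁ e′ rewrite par-+ (q * m) m | par-* q m | e | e′ = refl
    ...   | inj₂ e′ rewrite par-+ (q * m) m | par-* q m | e | e′ = refl
    main : ∀ r q → par (r + q * m + r) + par (r + q * m + (m + r)) ≡ par m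
    main r q = trans (cong₂ _+_ (red q r) (red′ q r)) (fin q)

  module _ (h : ℕ) where

    private N = m * (2 * h)

    ∑-ν : ∀ x → ∑ N (ν x) ≡ 2 * h
    ∑-ν x = begin
      ∑ N (ν x)                  ≡⟨ cong (λ z → ∑ z (ν x)) (*-comm m (2 * h)) ⟩
      ∑ (2 * h * m) (ν x)        ≡⟨ ∑-periodic (2 * h) m (ν x) (ν-+m x) ⟩
      2 * h * ∑ m (ν x)          ≡⟨ cong (2 * h *_) (∑-cong m λ y _ → sym (*-identityʳ (ν x y))) ⟩
      2 * h * ∑ m (λ y → ν x y * 1) ≡⟨ cong (2 * h *_) (∑-ν-block x (λ _ → 1)) ⟩
      2 * h * 1                  ≡⟨ *-identityʳ (2 * h) ⟩
      2 * h                      ∎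

    ∑-χ : ∀ x → ∑ N (χ x) + 2 * h ≡ N
    ∑-χ x = begin
      ∑ N (χ x) + 2 * h                ≡⟨ cong (∑ N (χ x) +_) (∑-ν x) ⟨
      ∑ N (χ x) + ∑ N (ν x)            ≡⟨ ∑-+ N (χ x) (ν x) ⟨
      ∑ N (λ y → χ x y + ν x y)        ≡⟨ ∑-cong N (λ y _ → χ+ν x y) ⟩
      ∑ N (λ _ → 1)                    ≡⟨ ∑-const N 1 ⟩
      N * 1                            ≡⟨ *-identityʳ N ⟩
      N                                ∎

    -- The summand has period 2m, a multiple of `m` and of 2. The range thus splits into `h` blocks,
    -- and in each block only the two residues of `par-pair` survive.
    ∑-νpar : ∀ x → ∑ N (λ y → ν x y * par (x + y)) ≡ h * par m
    ∑-νpar x = begin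
      ∑ N F                 ≡⟨ cong (λ z → ∑ z F) N≡ ⟩
      ∑ (h * (m + m)) F     ≡⟨ ∑-periodic h (m + m) F F-period ⟩
      h * ∑ (m + m) F       ≡⟨ cong (h *_) block ⟩
      h * par m             ∎
      where
      F : ℕ → ℕ
      F y = ν x y * par (x + y)
      N≡ : m * (2 * h) ≡ h * (m + m)
      N≡ = solve (m ∷ h ∷ [])
      F-period : ∀ y → F (m + m + y) ≡ F y
      F-period y = cong₂ _*_
        (trans (cong (ν x) (+-assoc m m y)) (trans (ν-+m x (m + y)) (ν-+m x y)))
        (par-drop (x + (m + m + y)) (x + y) m (solve (x ∷ y ∷ m ∷ [])))
      block : ∑ (m + m) F ≡ par m
      block = begin
        ∑ (m + m) F                                  ≡⟨ ∑-++ m m F ⟩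
        ∑ m F + ∑ m (λ y → F (m + y))
          ≡⟨ cong (∑ m F +_) (∑-cong m λ y _ → cong (_* par (x + (m + y))) (ν-+m x y)) ⟩
        ∑ m F + ∑ m (λ y → ν x y * par (x + (m + y)))
          ≡⟨ cong₂ _+_ (∑-ν-block x (λ y → par (x + y))) (∑-ν-block x (λ y → par (x + (m + y)))) ⟩
        par (x + x % m) + par (x + (m + x % m))      ≡⟨ par-pair x ⟩
        par m                                        ∎

    ∑-par : ∀ x → ∑ N (λ y → par (x + y)) ≡ h * m
    ∑-par x = begin
      ∑ N F            ≡⟨ cong (λ z → ∑ z F) N≡ ⟩
      ∑ (h * m * 2) F  ≡⟨ ∑-periodic (h * m) 2 F (λ y → par-drop (x + (2 + y)) (x + y) 1 (solve (x ∷ y ∷ []))) ⟩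
      h * m * ∑ 2 F    ≡⟨ cong (h * m *_) two ⟩
      h * m * 1        ≡⟨ *-identityʳ (h * m) ⟩
      h * m            ∎
      where
      F : ℕ → ℕ
      F y = par (x + y)
      N≡ : m * (2 * h) ≡ h * m * 2
      N≡ = solve (m ∷ h ∷ [])
      two : ∑ 2 F ≡ 1
      two with par-≤1 x
      ... | inj₁ e rewrite par-+ x 0 | par-+ x 1 | e = refl
      ... | inj₂ e rewrite par-+ x 0 | par-+ x 1 | e = refl

    -- All vertices of the opposite parity (`∑-par`) minus those in the part of `x` (`∑-νpar`): hm -
    -- h(m mod 2).
    ∑-χpar : ∀ x → ∑ N (λ y → χ x y * par (x + y)) ≡ 2 * (h * (m / 2))
    ∑-χpar x = +-cancelʳ-≡ (h * par m) _ _ (begin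
      ∑ N A + h * par m   ≡⟨ cong (∑ N A +_) (∑-νpar x) ⟨
      ∑ N A + ∑ N B       ≡⟨ ∑-+ N A B ⟨
      ∑ N (λ y → A y + B y)
        ≡⟨ ∑-cong N (λ y _ → trans (sym (*-distribʳ-+ (par (x + y)) (χ x y) (ν x y)))
                               (trans (cong (_* par (x + y)) (χ+ν x y)) (*-identityˡ _))) ⟩
      ∑ N (λ y → par (x + y))                ≡⟨ ∑-par x ⟩
      h * m                                  ≡⟨ cong (h *_) (m≡m%n+[m/n]*n m 2) ⟩
      h * (m % 2 + m / 2 * 2)                ≡⟨ fin (m % 2) (m / 2) ⟩
      2 * (h * (m / 2)) + h * par m          ∎)
      where
      A B : ℕ → ℕ
      A y = χ x y * par (x + y)
      B y = ν x y * par (x + y)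
      fin : ∀ a b → h * (a + b * 2) ≡ 2 * (h * b) + h * a
      fin a b = solve (h ∷ a ∷ b ∷ [])

-- Sums over the orbits of a permutation

least : ∀ {P : ℕ → Set} → Decidable P → ∀ n → P n → ∃ λ k → P k × (∀ j → j < k → ¬ P j)
least P? zero    p = 0 , p , λ _ ()
least P? (suc n) p with P? 0
... | yes p₀ = 0 , p₀ , λ _ ()
... | no ¬p₀ with least (P? ∘ suc) n p
...   | k , pk , below = suc k , pk , λ where
          zero    _         → ¬p₀
          (suc j) (s<s j<k) → below j j<k

Unique-++⁻ : ∀ {A : Set} (xs : List A) {ys} → Unique (xs ++ ys) →
             Unique ys × (∀ {x} → x ∈ ys → x ∉ xs)
Unique-++⁻ []       u         = u , λ _ ()
Unique-++⁻ (x ∷ xs) (x∉ AllPairs.∷ u) with Unique-++⁻ xs u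
... | u′ , disj = u′ , λ where
  y∈ (here refl) → All.lookup (All.++⁻ʳ xs x∉) y∈ refl
  y∈ (there y∈xs) → disj y∈ y∈xs

-- This is what splits an orbit off a list that contains it.
⊆⇒↭-++ : ∀ {A : Set} (xs {ys} : List A) → Unique xs → (∀ {x} → x ∈ xs → x ∈ ys) →
         ∃ λ zs → ys ↭ xs ++ zs
⊆⇒↭-++ []       {ys} _ _ = ys , ↭-refl
⊆⇒↭-++ (x ∷ xs) {ys} (x∉ AllPairs.∷ u) sub with ∈-∃++ (sub (here refl))
... | as , bs , refl with ⊆⇒↭-++ xs {as ++ bs} u sub′
  where
  sub′ : ∀ {y} → y ∈ xs → y ∈ as ++ bs
  sub′ y∈ with ∈-resp-↭ (↭-shift x as bs) (sub (there y∈))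
  ... | here refl = ⊥-elim (All.lookup x∉ y∈ refl)
  ... | there y∈′ = y∈′
...   | zs , p = zs , ↭-trans (↭-shift x as bs) (prep x p)

iter : ∀ {A : Set} → (A → A) → ℕ → A → A
iter f zero    x = x
iter f (suc k) x = f (iter f k x)

module _ {A : Set} (σ : A → A) where

  iter-+ : ∀ a b x → iter σ (a + b) x ≡ iter σ a (iter σ b x)
  iter-+ zero    b x = refl
  iter-+ (suc a) b x = cong σ (iter-+ a b x)

  iter-* : ∀ q p {x} → iter σ p x ≡ x → iter σ (q * p) x ≡ x
  iter-* zero    p     e = refl
  iter-* (suc q) p {x} e = trans (iter-+ p (q * p) x) (trans (cong (iter σ p) (iter-* q p e)) e)

  iter-suc : ∀ k x → iter σ k (σ x) ≡ iter σ (suc k) x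
  iter-suc zero    x = refl
  iter-suc (suc k) x = cong σ (iter-suc k x)

module OrbitSum {A : Set} (_≟_ : DecidableEquality A) (σ : A → A) (N′ : ℕ)
  (σ-order : ∀ x → iter σ (suc N′) x ≡ x)
  (g : A → ℕ) (g-invariant : ∀ x → g (σ x) ≡ g x)
  (M : ℕ) (M∣orbit : ∀ x p → p ∣ suc N′ → iter σ p x ≡ x → M ∣ p * g x) where

  σ-injective : ∀ {x y} → σ x ≡ σ y → x ≡ y
  σ-injective {x} {y} e = trans (sym (back x)) (trans (cong (iter σ N′) e) (back y))
    where
    back : ∀ z → iter σ N′ (σ z) ≡ z
    back z = trans (iter-suc σ N′ z) (σ-order z)

  iter-injective : ∀ k {x y} → iter σ k x ≡ iter σ k y → x ≡ y
  iter-injective zero    e = e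
  iter-injective (suc k) e = iter-injective k (σ-injective e)

  g-iter : ∀ k x → g (iter σ k x) ≡ g x
  g-iter zero    x = refl
  g-iter (suc k) x = trans (g-invariant _) (g-iter k x)

  Closed : List A → Set
  Closed U = ∀ {y} → y ∈ U → σ y ∈ U

  module Orbit (x : A) where

    private
      search = least (λ k → iter σ (suc k) x ≟ x) N′ (σ-order x)
      p′ = proj₁ search

    p : ℕ
    p = suc p′

    σᵖ : iter σ p x ≡ x
    σᵖ = proj₁ (proj₂ search)

    minimal : ∀ j → 0 < j → j < p → iter σ j x ≢ x
    minimal (suc j) _ (s<s j<p) = proj₂ (proj₂ search) j j<p

    -- The remainder of the order on division by `p` is again a return time of `x`, and it lies
    -- below the least positive one.
    p∣N : p ∣ suc N′
    p∣N with (suc N′ % p) in eq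
    ... | zero  = m%n≡0⇒n∣m (suc N′) p eq
    ... | suc r = ⊥-elim (minimal (suc r) z<s (subst (_< p) eq (m%n<n (suc N′) p)) (begin
        iter σ (suc r) x                          ≡⟨ cong (λ z → iter σ z x) eq ⟨
        iter σ (suc N′ % p) x                     ≡⟨ cong (iter σ (suc N′ % p)) (iter-* σ (suc N′ / p) p σᵖ) ⟨
        iter σ (suc N′ % p) (iter σ (suc N′ / p * p) x) ≡⟨ iter-+ σ (suc N′ % p) _ x ⟨
        iter σ (suc N′ % p + suc N′ / p * p) x    ≡⟨ cong (λ z → iter σ z x) (m≡m%n+[m/n]*n (suc N′) p) ⟨
        iter σ (suc N′) x                         ≡⟨ σ-order x ⟩
        x                                         ∎))

    orbit : List A
    orbit = applyUpTo (λ k → iter σ k x) p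

    orbit-unique : Unique orbit
    orbit-unique = Unique.applyUpTo⁺₁ _ p distinct
      where
      distinct : ∀ {i j} → i < j → j < p → iter σ i x ≢ iter σ j x
      distinct {i} {j} i<j j<p e = minimal (j ∸ i) (m<n⇒0<n∸m i<j)
        (≤-<-trans (m∸n≤m j i) j<p)
        (sym (iter-injective i (trans e (trans
          (cong (λ z → iter σ z x) (sym (m+[n∸m]≡n (<⇒≤ i<j)))) (iter-+ σ i (j ∸ i) x)))))

    orbit-⊆ : ∀ {U} → Closed U → x ∈ U → ∀ {y} → y ∈ orbit → y ∈ U
    orbit-⊆ {U} closed x∈ y∈ with ∈-applyUpTo⁻ (λ k → iter σ k x) y∈
    ... | i , _ , refl = go i
      where
      go : ∀ i → iter σ i x ∈ U
      go zero    = x∈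
      go (suc i) = closed (go i)

    -- By injectivity the predecessor of an orbit element is its predecessor on the orbit; for `x`
    -- itself this is the last element, since `x` equals `iter σ p x`. Hence the complement of an
    -- orbit in a closed list is closed.
    orbit-σ⁻ : ∀ {y} → σ y ∈ orbit → y ∈ orbit
    orbit-σ⁻ {y} σy∈ with ∈-applyUpTo⁻ (λ k → iter σ k x) σy∈
    ... | zero  , _    , e = subst (_∈ orbit) (sym (σ-injective (trans e (sym σᵖ)))) (∈-applyUpTo⁺ (λ k → iter σ k x) (n<1+n p′))
    ... | suc i , si<p , e = subst (_∈ orbit) (sym (σ-injective e)) (∈-applyUpTo⁺ (λ k → iter σ k x) (<-trans (n<1+n i) si<p))

    sum-orbit : sum (map g orbit) ≡ p * g x
    sum-orbit = go p (λ k → iter σ k x) (λ k → g-iter k x)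
      where
      go : ∀ n (f : ℕ → A) → (∀ k → g (f k) ≡ g x) → sum (map g (applyUpTo f n)) ≡ n * g x
      go zero    f e = refl
      go (suc n) f e = cong₂ _+_ (e 0) (go n (f ∘ suc) (e ∘ suc))

  -- Strong induction on the length, with `fuel` as its bound: the orbit of the head contributes a
  -- multiple of `M`, and the rest `V` is a shorter closed list.
  M∣sum : ∀ fuel U → length U ≤ fuel → Unique U → Closed U → M ∣ sum (map g U)
  M∣sum _          []        _   _ _      = M ∣0
  M∣sum (suc fuel) U@(x ∷ _) len u closed
    with ⊆⇒↭-++ (Orbit.orbit x) (Orbit.orbit-unique x) (Orbit.orbit-⊆ x closed (here refl))
  ... | V , U↭ = subst (M ∣_) (sym sum≡) (∣m∣n⇒∣m+n (M∣orbit x p p∣N σᵖ) (M∣sum fuel V len′ V-unique V-closed))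
    where
    open Orbit x
    parts = Unique-++⁻ orbit (Unique-resp-↭ (setoid A) (↭⇒↭ₛ U↭) u)
    V-unique : Unique V
    V-unique = proj₁ parts
    V-closed : Closed V
    V-closed {y} y∈ with ∈-++⁻ orbit (∈-resp-↭ U↭ (closed (∈-resp-↭ (↭-sym U↭) (∈-++⁺ʳ orbit y∈))))
    ... | inj₁ σy∈ = ⊥-elim (proj₂ parts y∈ (orbit-σ⁻ σy∈))
    ... | inj₂ σy∈ = σy∈
    sum≡ : sum (map g U) ≡ p * g x + sum (map g V)
    sum≡ = trans (sum-↭ (map⁺ g U↭)) (trans (cong sum (map-++ g orbit V))
      (trans (sum-++ (map g orbit) (map g V)) (cong (_+ sum (map g V)) sum-orbit)))
    len′ : length V ≤ fuel
    len′ = s≤s⁻¹ (≤-trans (s≤s (m≤n+m (length V) (p ∸ 1))) (≤-trans (≤-reflexive (sym (begin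
      length U                        ≡⟨ ↭-length U↭ ⟩
      length (orbit ++ V)             ≡⟨ length-++ orbit ⟩
      length orbit + length V         ≡⟨ cong (_+ length V) (length-applyUpTo (λ k → iter σ k x) p) ⟩
      p + length V                    ∎))) len))

-- Odd factors and powers of two

Odd : ℕ → Set
Odd n = ∃ λ v → n ≡ 1 + v * 2

even⊎odd : ∀ n → 2 ∣ n ⊎ Odd n
even⊎odd zero = inj₁ (2 ∣0)
even⊎odd (suc n) with even⊎odd n
... | inj₁ (divides q e) = inj₂ (q , cong suc e)
... | inj₂ (v , e)       = inj₁ (divides (suc v) (cong suc e))

2∣odd*⇒2∣ : ∀ {w x} → Odd w → 2 ∣ w * x → 2 ∣ x
2∣odd*⇒2∣ {_} {x} (v , refl) 2∣wx = ∣m+n∣m⇒∣n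
  (subst (2 ∣_) (+-comm x (v * 2 * x)) 2∣wx) (∣m⇒∣m*n x (n∣m*n v))

2^∣odd*⇒2^∣ : ∀ a {w x} → Odd w → 2 ^ a ∣ w * x → 2 ^ a ∣ x
2^∣odd*⇒2^∣ zero        {x = x} _ _ = 1∣ x
2^∣odd*⇒2^∣ (suc a) {w} {x} ow d with 2∣odd*⇒2∣ ow (m*n∣⇒m∣ 2 (2 ^ a) d)
... | divides y refl = subst (2 * 2 ^ a ∣_) (*-comm 2 y)
  (*-monoʳ-∣ 2 (2^∣odd*⇒2^∣ a ow (*-cancelˡ-∣ 2 (subst (2 * 2 ^ a ∣_) eq d))))
  where
  eq : w * (y * 2) ≡ 2 * (w * y)
  eq = solve (w ∷ y ∷ [])

2-adic : ∀ fuel n → n ≤ fuel → 0 < n → ∃₂ λ e q → Odd q × n ≡ 2 ^ e * q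
2-adic zero       _ z≤n ()
2-adic (suc fuel) n n≤ 0<n with even⊎odd n
... | inj₂ odd = 0 , n , odd , sym (*-identityˡ n)
... | inj₁ (divides (suc v) refl) with 2-adic fuel (suc v)
                                         (s≤s⁻¹ (≤-trans (s≤s (s≤s (m≤m*n v 2))) n≤)) z<s
...   | e , q , odd , eq = suc e , q , odd , (begin
  suc v * 2        ≡⟨ *-comm (suc v) 2 ⟩
  2 * suc v        ≡⟨ cong (2 *_) eq ⟩
  2 * (2 ^ e * q)  ≡⟨ *-assoc 2 (2 ^ e) q ⟨
  2 * 2 ^ e * q    ∎)

-- Arithmetic of reflected positions

cong-* : ∀ {M a b} x → Cong M a b → Cong M (x * a) (x * b)
cong-* {M} {a} {b} x (offset u v e) = offset (x * u) (x * v) (trans (lem a u) (trans (cong (x *_) e) (sym (lem b v))))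
  where
  lem : ∀ a u → x * a + x * u * M ≡ x * (a + u * M)
  lem a u = solve (x ∷ a ∷ u ∷ M ∷ [])

cong-suc : ∀ {M a b} → Cong M a b → Cong M (suc a) (suc b)
cong-suc (offset u v e) = offset u v (cong suc e)

-- In this group ε = ℓ - 1 plays the part of -1 modulo ℓ, so that a reflection is the map sending
-- `k` to `r + ε * k`. Together with `reflect₀`, edge `k` goes to edge `r + k′`, traversed
-- backwards.
reflect₁ : ∀ {ℓ} r {ε} → suc ε ≡ ℓ → ∀ k k′ → suc (k + k′) ≡ ℓ → Cong ℓ (r + ε * suc k) (r + k′)
reflect₁ r refl k k′ refl = offset 1 (suc k) eq
  where
  eq : r + (k + k′) * (1 + k) + 1 * (1 + (k + k′)) ≡ r + k′ + (1 + k) * (1 + (k + k′))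
  eq = solve (r ∷ k ∷ k′ ∷ [])

reflect₀ : ∀ {ℓ} r {ε} → suc ε ≡ ℓ → ∀ k k′ → suc (k + k′) ≡ ℓ → Cong ℓ (r + ε * k) (suc (r + k′))
reflect₀ r refl k k′ refl = offset 1 k eq
  where
  eq : r + (k + k′) * k + 1 * (1 + (k + k′)) ≡ 1 + (r + k′) + k * (1 + (k + k′))
  eq = solve (r ∷ k ∷ k′ ∷ [])

reflect-fix : ∀ {ℓ ε r} → suc ε ≡ ℓ → ∀ j → r ≡ j * 2 → Cong ℓ (r + ε * j) j
reflect-fix {ε = ε} refl j refl = offset 0 j eq
  where
  eq : j * 2 + ε * j + 0 ≡ j + j * (1 + ε)
  eq = solve (j ∷ ε ∷ [])

reflect-pred : ∀ {ℓ ε r} → suc ε ≡ ℓ → ∀ j → r ≡ j * 2 → Cong ℓ (r + ε * suc j) (j + ε)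
reflect-pred {ε = ε} refl j refl = offset 0 j eq
  where
  eq : j * 2 + ε * (1 + j) + 0 ≡ j + ε + j * (1 + ε)
  eq = solve (j ∷ ε ∷ [])

reflect-edge : ∀ {ℓ ε r} → suc ε ≡ ℓ → ∀ j → r ≡ 1 + j * 2 → Cong ℓ (r + ε * suc j) j
reflect-edge {ε = ε} refl j refl = offset 0 (suc j) eq
  where
  eq : 1 + j * 2 + ε * (1 + j) + 0 ≡ j + (1 + j) * (1 + ε)
  eq = solve (j ∷ ε ∷ [])

reflect-twice : ∀ {ℓ ε} → suc ε ≡ ℓ → ∀ r → Cong ℓ (r + ε * (r + ε * 0)) 0
reflect-twice {ε = ε} refl r = offset 0 r eq
  where
  eq : r + ε * (r + ε * 0) + 0 ≡ r * (1 + ε)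
  eq = solve (r ∷ ε ∷ [])

halve-∣ : ∀ m h p → m * (2 * h) ∣ p + p → m ∣ p
halve-∣ m h p (divides z eq) = divides (z * h) (*-cancelˡ-≡ p (z * h * m) 2
  (trans (cong (p +_) (+-identityʳ p)) (trans eq lem)))
  where
  lem : z * (m * (2 * h)) ≡ 2 * (z * h * m)
  lem = solve (z ∷ m ∷ h ∷ [])

∑-rotate : ∀ ℓ (f : ℕ → ℕ) → (∀ k → f (ℓ + k) ≡ f k) → ∀ r → ∑ ℓ (λ k → f (r + k)) ≡ ∑ ℓ f
∑-rotate ℓ f per zero    = refl
∑-rotate ℓ f per (suc r) = trans (∑-rotate ℓ (f ∘ suc)
    (λ k → trans (cong f (sym (+-suc ℓ k))) (per (suc k))) r)
  (+-cancelˡ-≡ (f 0) _ _ (begin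
    f 0 + ∑ ℓ (f ∘ suc)        ≡⟨ cong (λ z → ∑ z f) (+-comm 1 ℓ) ⟩
    ∑ (ℓ + 1) f                ≡⟨ ∑-++ ℓ 1 f ⟩
    ∑ ℓ f + (f (ℓ + 0) + 0)    ≡⟨ cong (∑ ℓ f +_) (trans (+-identityʳ _) (per 0)) ⟩
    ∑ ℓ f + f 0                ≡⟨ +-comm (∑ ℓ f) (f 0) ⟩
    f 0 + ∑ ℓ f                ∎))

∑-reverse : ∀ n (f g : ℕ → ℕ) → (∀ k k′ → suc (k + k′) ≡ n → f k ≡ g k′) → ∑ n f ≡ ∑ n g
∑-reverse zero    f g e = refl
∑-reverse (suc n) f g e = begin
  f 0 + ∑ n (f ∘ suc)        ≡⟨ cong₂ _+_ (e 0 n refl) (∑-reverse n (f ∘ suc) g λ k k′ eq → e (suc k) k′ (cong suc eq)) ⟩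
  g n + ∑ n g                ≡⟨ +-comm (g n) (∑ n g) ⟩
  ∑ n g + g n                ≡⟨ cong (∑ n g +_) (trans (cong g (sym (+-identityʳ n))) (sym (+-identityʳ _))) ⟩
  ∑ n g + (g (n + 0) + 0)    ≡⟨ ∑-++ n 1 g ⟨
  ∑ (n + 1) g                ≡⟨ cong (λ z → ∑ z g) (+-comm n 1) ⟩
  ∑ (suc n) g                ∎

sum-+ : ∀ {A : Set} (f g : A → ℕ) xs → sum (map (λ x → f x + g x) xs) ≡ sum (map f xs) + sum (map g xs)
sum-+ f g []       = refl
sum-+ f g (x ∷ xs) = trans (cong (f x + g x +_) (sum-+ f g xs))
  (interchange +-commutativeSemigroup (f x) (g x) (sum (map f xs)) (sum (map g xs)))

sum-const : ∀ {A : Set} a (xs : List A) → sum (map (λ _ → a) xs) ≡ length xs * a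
sum-const a []       = refl
sum-const a (x ∷ xs) = cong (a +_) (sum-const a xs)

-- Cyclic systems as families of periodic sequences

-- Periodic sequences turn rotations and reflections into affine maps of positions, and indices turn
-- the translation by 1 into a map `next`. That the edges are partitioned enters twice: as
-- uniqueness of the cycle through an edge, in either direction, and as `edge-sum`, where the
-- ordered pairs on the right meet each edge twice.
record CyclicFamily (m n ℓ s : ℕ) : Set where
  field
    c        : Fin s → ℕ → ℕ
    periodic : ∀ i {k k′} → Cong ℓ k k′ → c i k ≡ c i k′
    distinct : ∀ i {k k′} → c i k ≡ c i k′ → Cong ℓ k k′
    bounded  : ∀ i k → c i k < m * n
    adjacent : ∀ i k → Adj m (c i k) (c i (suc k))
    disjoint : ∀ {i j k k′} → c i k ≡ c j k′ → c i (suc k) ≡ c j (suc k′) → i ≡ j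
    disjoint′ : ∀ {i j k k′} → c i k ≡ c j (suc k′) → c i (suc k) ≡ c j k′ → i ≡ j
    next     : Fin s → Fin s
    next-shift : ∀ i → ∃₂ λ r ε → (ε ≡ 1 ⊎ suc ε ≡ ℓ) ×
                 (∀ k → Cong (m * n) (c (next i) k) (c i (r + ε * k) + 1))
    edge-sum : ∀ (f : ℕ → ℕ → ℕ) → (∀ x y → f x y ≡ f y x) → (∀ x y → ¬ Adj m x y → f x y ≡ 0) →
               2 * sum (map (λ i → ∑ ℓ λ k → f (c i k) (c i (suc k))) (allFin s))
               ≡ ∑ (m * n) λ x → ∑ (m * n) (f x)

module FamilyParity (m h ℓ s : ℕ) .{{_ : NonZero m}} .{{_ : NonZero h}} (3≤ℓ : 3 ≤ ℓ)
  (F : CyclicFamily m (2 * h) ℓ s) where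

  open CyclicFamily F

  N : ℕ
  N = m * (2 * h)

  0<N : 0 < N
  0<N = *-mono-< {0} {m} (>-nonZero⁻¹ m) (*-mono-< {0} {2} {0} {h} z<s (>-nonZero⁻¹ h))

  2∣N : 2 ∣ N
  2∣N = ∣n⇒∣m*n m (m∣m*n h)

  Sign : ℕ → Set
  Sign ε = ε ≡ 1 ⊎ suc ε ≡ ℓ

  Sign-* : ∀ {ε ε′} → Sign ε → Sign ε′ → ∃ λ ε″ → Sign ε″ × Cong ℓ (ε * ε′) ε″
  Sign-* {_} {ε′} (inj₁ refl) s′ = ε′ , s′ , cong-refl (*-identityˡ ε′)
  Sign-* {ε} {_} (inj₂ e) (inj₁ refl) = ε , inj₂ e , cong-refl (*-identityʳ ε)
  Sign-* {ε} {_} (inj₂ refl) (inj₂ refl) = 1 , inj₁ refl , offset 1 ε eq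
    where
    eq : ε * ε + 1 * (1 + ε) ≡ 1 + ε * (1 + ε)
    eq = solve (ε ∷ [])

  cong-+ℓ : ∀ k → Cong ℓ (ℓ + k) k
  cong-+ℓ k = offset 0 1 (trans (+-identityʳ _) (trans (+-comm ℓ k) (cong (k +_) (sym (+-identityʳ ℓ)))))

  -- Cycle j is cycle i translated by t, up to rotation (ε = 1) and reflection (ε ≡ -1 mod ℓ).
  Translate : ℕ → Fin s → Fin s → Set
  Translate t i j = ∃₂ λ r ε → Sign ε × (∀ k → Cong N (c j k) (c i (r + ε * k) + t))

  Translate-refl : ∀ i → Translate 0 i i
  Translate-refl i = 0 , 1 , inj₁ refl , λ k →
    cong-refl (trans (cong (c i) (sym (*-identityˡ k))) (sym (+-identityʳ _)))

  Translate-trans : ∀ {t t′ i j k} → Translate t i j → Translate t′ j k → Translate (t′ + t) i k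
  Translate-trans {t} {t′} {i} {j} {k} (r , ε , s₁ , e₁) (r′ , ε′ , s₂ , e₂) with Sign-* s₁ s₂
  ... | ε″ , s₃ , e₃ = r + ε * r′ , ε″ , s₃ , λ x → cong-trans (e₂ x)
      (cong-trans (cong-+ {c = t′} (e₁ (r′ + ε′ * x)) (cong-refl refl)) (cong-refl (begin
        c i (r + ε * (r′ + ε′ * x)) + t + t′
          ≡⟨ cong (λ z → z + t + t′) (periodic i (position x)) ⟩
        c i (r + ε * r′ + ε″ * x) + t + t′    ≡⟨ +-assoc _ t t′ ⟩
        c i (r + ε * r′ + ε″ * x) + (t + t′)  ≡⟨ cong (c i (r + ε * r′ + ε″ * x) +_) (+-comm t t′) ⟩
        c i (r + ε * r′ + ε″ * x) + (t′ + t)  ∎)))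
    where
    rearrange : ∀ x → r + ε * (r′ + ε′ * x) ≡ r + ε * r′ + x * (ε * ε′)
    rearrange x = solve (r ∷ ε ∷ r′ ∷ ε′ ∷ x ∷ [])
    position : ∀ x → Cong ℓ (r + ε * (r′ + ε′ * x)) (r + ε * r′ + ε″ * x)
    position x = cong-trans (cong-refl (rearrange x))
      (cong-trans (cong-+ {a = r + ε * r′} (cong-refl refl) (cong-* x e₃))
        (cong-refl (cong (r + ε * r′ +_) (*-comm x ε″))))

  Translate-iter : ∀ p i → Translate p i (iter next p i)
  Translate-iter zero    i = Translate-refl i
  Translate-iter (suc p) i = Translate-trans (Translate-iter p i) (next-shift (iter next p i))

  cong-+N : ∀ {a t} → N ∣ t → Cong N (a + t) a
  cong-+N {a} {t} N∣t = cong-trans (cong-+ {a = a} (cong-refl refl) (∣⇒cong0 N∣t)) (cong-refl (+-identityʳ a))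

  +-cong⁻ : ∀ {a t} → Cong N a (a + t) → N ∣ t
  +-cong⁻ {a} {t} e = cong0⇒∣ (cong-sym (cong-+-cancelˡ a (cong-trans (cong-refl (+-identityʳ a)) e)))

  -- Such a translation moves no vertex, so the two cycles share an edge. After a reflection the
  -- shared edge joins positions `r + ε` and `r` of cycle `i` and is met in the opposite direction.
  Translate-≡ : ∀ {t i j} → N ∣ t → Translate t i j → j ≡ i
  Translate-≡ {t} {i} {j} N∣t (r , ε , sgn , e) = go sgn
    where
    at : ∀ k → c j k ≡ c i (r + ε * k)
    at k = cong⇒≡ (bounded j k) (bounded i _) (cong-trans (e k) (cong-+N N∣t))
    go : Sign ε → j ≡ i
    go (inj₁ refl) = disjoint {k = 0} {k′ = r}
      (trans (at 0) (cong (c i) (+-identityʳ r))) (trans (at 1) (cong (c i) (+-comm r 1)))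
    go (inj₂ refl) = disjoint′ {k = 0} {k′ = r + ε}
      (trans (at 0) (periodic i (offset 1 0 eq)))
      (trans (at 1) (cong (λ z → c i (r + z)) (*-identityʳ ε)))
      where
      eq : r + ε * 0 + 1 * (1 + ε) ≡ 1 + (r + ε) + 0 * (1 + ε)
      eq = solve (r ∷ ε ∷ [])

  -- This makes `next` a permutation whose orbit lengths divide `N`, as `OrbitSum` requires.
  next-order : ∀ i → iter next N i ≡ i
  next-order i = Translate-≡ ∣-refl (Translate-iter N i)

  -- Odd edges under translation

  bit : Fin s → ℕ → ℕ
  bit i k = par (c i k + c i (suc k))

  odd-edges : Fin s → ℕ
  odd-edges i = ∑ ℓ (bit i)

  bit-periodic : ∀ i {k k′} → Cong ℓ k k′ → bit i k ≡ bit i k′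
  bit-periodic i e = cong par (cong₂ _+_ (periodic i e) (periodic i (cong-suc e)))

  bit-+ℓ : ∀ i k → bit i (ℓ + k) ≡ bit i k
  bit-+ℓ i k = bit-periodic i (cong-+ℓ k)

  cong-N⇒par : ∀ a b → Cong N a b → par a ≡ par b
  cong-N⇒par a b e = cong⇒% {2} {a} {b} (cong-∣ 2∣N e)

  -- Translating both ends by `t` changes their sum by 2t, and reduction modulo the even number `N`
  -- keeps parity.
  bit-translate : ∀ {i j t} k x y → Cong N (c j k) (c i x + t) → Cong N (c j (suc k)) (c i y + t) →
                  bit j k ≡ par (c i x + c i y)
  bit-translate {i} {j} {t} k x y e e′ = trans
    (cong-N⇒par (c j k + c j (suc k)) (c i x + t + (c i y + t)) (cong-+ e e′))
    (par-drop _ _ t (lem (c i x) (c i y)))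
    where
    lem : ∀ a b → a + t + (b + t) ≡ a + b + t * 2
    lem a b = solve (a ∷ b ∷ t ∷ [])

  odd-edges-next : ∀ i → odd-edges (next i) ≡ odd-edges i
  odd-edges-next i with next-shift i
  ... | r , _ , inj₁ refl , e = trans
    (∑-cong ℓ λ k _ → bit-translate {i} {next i} k (r + k) (suc (r + k))
      (cong-trans (e k) (cong-refl (cong (λ z → c i (r + z) + 1) (*-identityˡ k))))
      (cong-trans (e (suc k)) (cong-refl (cong (λ z → c i z + 1) (trans (cong (r +_) (*-identityˡ (suc k))) (+-suc r k))))))
    (∑-rotate ℓ (bit i) (bit-+ℓ i) r)
  -- A reflection pairs edge `k` with the backward edge `r + k′`, where k + k′ = ℓ - 1; the sum over
  -- a period is therefore reversed and then rotated.
  ... | r , ε , inj₂ ε+1≡ℓ , e = trans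
    (∑-reverse ℓ (bit (next i)) (λ k → bit i (r + k)) λ k k′ eq → trans
      (bit-translate {i} {next i} k (r + ε * k) (r + ε * suc k) (e k) (e (suc k)))
      (cong par (trans (+-comm (c i (r + ε * k)) _) (cong₂ _+_
        (periodic i (reflect₁ r ε+1≡ℓ k k′ eq)) (periodic i (reflect₀ r ε+1≡ℓ k k′ eq))))))
    (∑-rotate ℓ (bit i) (bit-+ℓ i) r)

  iterate-shift : ∀ {i r p} → (∀ k → Cong N (c i k) (c i (r + k) + p)) →
                  ∀ d k → Cong N (c i k) (c i (d * r + k) + d * p)
  iterate-shift {i} e zero k = cong-refl (sym (+-identityʳ (c i k)))
  iterate-shift {i} {r} {p} e (suc d) k = cong-trans (e k)
    (cong-trans (cong-+ {c = p} (iterate-shift {i} e d (r + k)) (cong-refl refl)) (cong-refl (begin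
      c i (d * r + (r + k)) + d * p + p    ≡⟨ cong (λ z → c i z + d * p + p) position ⟩
      c i (r + d * r + k) + d * p + p      ≡⟨ +-assoc _ (d * p) p ⟩
      c i (r + d * r + k) + (d * p + p)    ≡⟨ cong (c i (r + d * r + k) +_) (+-comm (d * p) p) ⟩
      c i (r + d * r + k) + (p + d * p)    ∎)))
    where
    position : d * r + (r + k) ≡ r + d * r + k
    position = solve (d ∷ r ∷ k ∷ [])

  -- The map sending `k` to r - k modulo ℓ fixes a position if `r` is even and exchanges two
  -- consecutive positions if `r` is odd.
  no-reflection : ∀ {i r ε p} → suc ε ≡ ℓ → ¬ (∀ k → Cong N (c i k) (c i (r + ε * k) + p))
  no-reflection {i} {r} {ε} {p} ε+1≡ℓ e = go (even⊎odd r)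
    where
    fixes : ∀ {k k′} → Cong ℓ (r + ε * k) k′ → Cong N (c i k) (c i k′ + p)
    fixes {k} {k′} eq = cong-trans (e k) (cong-refl (cong (_+ p) (periodic i eq)))

    -- Here N divides p, so no vertex moves, and positions j + 1 and j - 1 carry the same vertex.
    -- Distinctness then gives ℓ = 2.
    fixed-vertex : ∀ j → r ≡ j * 2 → ⊥
    fixed-vertex j r≡ = <-irrefl (trans (cong suc 1≡ε) ε+1≡ℓ) 3≤ℓ
      where
      N∣p : N ∣ p
      N∣p = +-cong⁻ {c i j} (fixes (reflect-fix ε+1≡ℓ j r≡))
      same : c i (suc j) ≡ c i (j + ε)
      same = cong⇒≡ (bounded i _) (bounded i _)
        (cong-trans (fixes (reflect-pred ε+1≡ℓ j r≡)) (cong-+N N∣p))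
      1≡ε : 1 ≡ ε
      1≡ε = cong⇒≡ (<-trans (n<1+n 1) 3≤ℓ) (≤-reflexive ε+1≡ℓ)
        (cong-+-cancelˡ j (cong-trans (cong-refl (+-comm j 1)) (distinct i same)))

    -- Reflecting twice brings position 0 back while adding `p` twice. Hence `p` is a multiple of
    -- N/2 = hm, and the two ends of an exchanged edge would lie in one part.
    N∣2p : N ∣ p + p
    N∣2p = +-cong⁻ {c i 0} (cong-trans (e 0) (cong-trans
      (cong-+ {c = p} (fixes {r + ε * 0} {0} (reflect-twice ε+1≡ℓ r)) (cong-refl refl))
      (cong-refl (+-assoc (c i 0) p p))))

    m∣p : m ∣ p
    m∣p = halve-∣ m h p N∣2p

    fixed-edge : ∀ j → r ≡ 1 + j * 2 → ⊥
    fixed-edge j r≡ = adjacent i j (cong⇒∣∣-∣ (c i j) (c i (suc j)) (cong-sym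
      (cong-trans (cong-∣ (m∣m*n (2 * h)) (fixes (reflect-edge ε+1≡ℓ j r≡)))
        (cong-trans (cong-+ {a = c i j} (cong-refl refl) (∣⇒cong0 m∣p)) (cong-refl (+-identityʳ (c i j)))))))

    go : 2 ∣ r ⊎ Odd r → ⊥
    go (inj₁ (divides j r≡)) = fixed-vertex j r≡
    go (inj₂ (j , r≡))       = fixed-edge j r≡

  -- Telescoping modulo 2: each inner vertex of the walk belongs to two of its edges, so only the
  -- two ends remain.
  ∑-bit : ∀ i a k → 2 ∣ ∑ a (λ x → bit i (k + x)) + (c i k + c i (a + k))
  ∑-bit i zero k = divides (c i k) (trans (cong (c i k +_) (sym (+-identityʳ _))) (*-comm 2 (c i k)))
  ∑-bit i (suc a) k = m%n≡0⇒n∣m _ 2 (begin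
    par (bit i (k + 0) + ∑ a (λ x → bit i (k + suc x)) + (c i k + c i (suc a + k)))
      ≡⟨ cong par (cong₂ (λ u v → u + v + (c i k + c i (suc a + k))) (cong (bit i) (+-identityʳ k))
           (∑-cong a λ x _ → cong (bit i) (+-suc k x))) ⟩
    par (par (c i k + c i (suc k)) + S + (c i k + c i (suc a + k)))
      ≡⟨ step (c i k) (c i (suc k)) (c i (suc a + k)) ⟩
    par (S + (c i (suc k) + c i (suc a + k)))
      ≡⟨ cong (λ z → par (S + (c i (suc k) + c i z))) (sym (+-suc a k)) ⟩
    par (S + (c i (suc k) + c i (a + suc k)))
      ≡⟨ n∣m⇒m%n≡0 _ 2 (∑-bit i a (suc k)) ⟩
    0 ∎)
    where
    S = ∑ a (λ x → bit i (suc k + x))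
    step : ∀ x y z → par (par (x + y) + S + (x + z)) ≡ par (S + (y + z))
    step x y z = trans (cong⇒% {2} (cong-+ {c = x + z}
        (cong-+ {c = S} (cong-sym (%-cong (x + y))) (cong-refl refl)) (cong-refl refl)))
      (par-drop _ _ x (lem S))
      where
      lem : ∀ S → x + y + S + (x + z) ≡ S + (y + z) + x * 2
      lem S = solve (x ∷ y ∷ z ∷ S ∷ [])

  odd-edges-even : ∀ i → 2 ∣ odd-edges i
  odd-edges-even i = ∣m+n∣m⇒∣n (subst (2 ∣_) (+-comm (odd-edges i) _) (∑-bit i ℓ 0))
    (divides (c i 0) (trans (cong (c i 0 +_) (trans (periodic i (cong-+ℓ 0)) (sym (+-identityʳ _)))) (*-comm 2 (c i 0))))

  -- The power of two in the weight of an orbit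

  module _ (e : ℕ) (2^e∣N : 2 ^ e ∣ N) where

    even-rotation-weight : ∀ i r p d w → 2 ∣ d → N ≡ d * p →
      (∀ k → Cong N (c i k) (c i (r + k) + p)) → d * r ≡ w * ℓ → 2 ^ suc e ∣ p * (odd-edges i + N)
    even-rotation-weight i r p d w (divides d₂ d≡) N≡dp shift-p dr≡wℓ =
      2^∣odd*⇒2^∣ (suc e) w-odd (∣-trans (*-monoʳ-∣ 2 2^e∣N) 2N∣)
      where
      o oᵣ : ℕ
      o = odd-edges i
      oᵣ = ∑ r (bit i)
      bit-+r : ∀ k → bit i (r + k) ≡ bit i k
      bit-+r k = sym (bit-translate {i} {i} k (r + k) (suc (r + k)) (shift-p k)
        (cong-trans (shift-p (suc k)) (cong-refl (cong (λ z → c i z + p) (+-suc r k)))))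
      -- The sequence of bits has period `ℓ` and, by the translation, also period `r`; d r = w ℓ
      -- terms are counted both ways.
      w*o≡d*oᵣ : w * o ≡ d * oᵣ
      w*o≡d*oᵣ = begin
        w * ∑ ℓ (bit i)    ≡⟨ ∑-periodic w ℓ (bit i) (bit-+ℓ i) ⟨
        ∑ (w * ℓ) (bit i)  ≡⟨ cong (λ z → ∑ z (bit i)) dr≡wℓ ⟨
        ∑ (d * r) (bit i)  ≡⟨ ∑-periodic d r (bit i) bit-+r ⟩
        d * ∑ r (bit i)    ∎
      -- If w were even, d/2 translations by p would rotate the cycle by (w/2)ℓ places, so every
      -- vertex would stay where it is; yet they add up to N/2, which `N` does not divide.
      w-odd : Odd w
      w-odd with even⊎odd w
      ... | inj₂ odd = odd
      ... | inj₁ (divides w₂ w≡) = ⊥-elim (<⇒≱ d₂p<N (∣⇒≤ {{>-nonZero 0<d₂p}} N∣d₂p))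
        where
        N≡2d₂p : N ≡ d₂ * p + d₂ * p
        N≡2d₂p = trans N≡dp (trans (cong (_* p) d≡) (lem d₂))
          where
          lem : ∀ d₂ → d₂ * 2 * p ≡ d₂ * p + d₂ * p
          lem d₂ = solve (d₂ ∷ p ∷ [])
        0<d₂p : 0 < d₂ * p
        0<d₂p with d₂ * p | N≡2d₂p
        ... | zero  | N≡0 = ⊥-elim (<-irrefl (sym N≡0) 0<N)
        ... | suc _ | _   = z<s
        d₂p<N : d₂ * p < N
        d₂p<N = subst (d₂ * p <_) (sym N≡2d₂p) (m<m+n (d₂ * p) 0<d₂p)
        halves : d₂ * r ≡ w₂ * ℓ
        halves = *-cancelˡ-≡ (d₂ * r) (w₂ * ℓ) 2 (trans (lem d₂ r)
          (trans (cong (_* r) (sym d≡)) (trans dr≡wℓ (trans (cong (_* ℓ) w≡) (sym (lem w₂ ℓ))))))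
          where
          lem : ∀ a b → 2 * (a * b) ≡ a * 2 * b
          lem a b = solve (a ∷ b ∷ [])
        N∣d₂p : N ∣ d₂ * p
        N∣d₂p = +-cong⁻ {c i 0} (cong-trans (iterate-shift {i} shift-p d₂ 0) (cong-refl
          (cong (_+ d₂ * p) (periodic i (offset 0 w₂
            (trans (+-identityʳ _) (trans (+-identityʳ _) halves)))))))
      -- The walk from position 0 to position `r` ends at a vertex congruent to its start minus `p`;
      -- `∑-bit` compares these parities.
      oᵣ+p-even : 2 ∣ oᵣ + p
      oᵣ+p-even = cong0⇒∣ (cong-trans (offset (c i r) 0 (lem oᵣ (c i r)))
        (cong-trans (cong-+ {a = oᵣ} (cong-refl refl) (cong-+ {c = c i r} c₀ (cong-refl refl)))
          (∣⇒cong0 (subst (λ z → 2 ∣ oᵣ + (c i 0 + c i z)) (+-identityʳ r) (∑-bit i r 0)))))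
        where
        c₀ : Cong 2 (c i r + p) (c i 0)
        c₀ = cong-sym (cong-∣ 2∣N (cong-trans (shift-p 0) (cong-refl (cong (λ z → c i z + p) (+-identityʳ r)))))
        lem : ∀ o x → o + p + x * 2 ≡ o + (x + p + x) + 0 * 2
        lem o x = solve (o ∷ x ∷ p ∷ [])
      -- Multiplication by w replaces p·w·o by p·d·oᵣ = N·oᵣ and so exposes the factor N. The
      -- cofactor oᵣ + wp is even because w is odd; oddness also lets w be cancelled from the power
      -- of two.
      2N∣ : 2 * N ∣ w * (p * (o + N))
      2N∣ = subst (2 * N ∣_) (sym eq) (subst (_∣ N * (oᵣ + w * p)) (*-comm N 2) (*-monoʳ-∣ N even))
        where
        v = proj₁ w-odd
        even : 2 ∣ oᵣ + w * p
        even = subst (2 ∣_) (trans (lem oᵣ v) (cong (λ z → oᵣ + z * p) (sym (proj₂ w-odd))))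
          (∣m∣n⇒∣m+n oᵣ+p-even (m∣m*n (v * p)))
          where
          lem : ∀ o v → o + p + 2 * (v * p) ≡ o + (1 + v * 2) * p
          lem o v = solve (o ∷ v ∷ p ∷ [])
        eq : w * (p * (o + N)) ≡ N * (oᵣ + w * p)
        eq = begin
          w * (p * (o + N))            ≡⟨ lem w o N ⟩
          p * (w * o) + N * (w * p)    ≡⟨ cong (λ z → p * z + N * (w * p)) w*o≡d*oᵣ ⟩
          p * (d * oᵣ) + N * (w * p)   ≡⟨ lem′ oᵣ (N * (w * p)) ⟩
          d * p * oᵣ + N * (w * p)     ≡⟨ cong (λ z → z * oᵣ + N * (w * p)) N≡dp ⟨
          N * oᵣ + N * (w * p)         ≡⟨ *-distribˡ-+ N oᵣ (w * p) ⟨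
          N * (oᵣ + w * p)             ∎
          where
          lem : ∀ w o N → w * (p * (o + N)) ≡ p * (w * o) + N * (w * p)
          lem w o N = solve (w ∷ o ∷ N ∷ p ∷ [])
          lem′ : ∀ a b → p * (d * a) + b ≡ d * p * a + b
          lem′ a b = solve (d ∷ p ∷ a ∷ b ∷ [])

    rotation-weight : ∀ i r p d → N ≡ d * p → (∀ k → Cong N (c i k) (c i (r + k) + p)) →
                      2 ^ suc e ∣ p * (odd-edges i + N)
    rotation-weight i r p d N≡dp shift-p with even⊎odd d
    -- For odd d the whole power `2 ^ e` already divides p. The extra 2 comes from o(C) + N, since a
    -- closed walk has an even number of odd edges.
    ... | inj₂ odd-d = subst (_∣ p * (odd-edges i + N)) (*-comm (2 ^ e) 2) (*-pres-∣
        (2^∣odd*⇒2^∣ e odd-d (subst (2 ^ e ∣_) N≡dp 2^e∣N))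
        (∣m∣n⇒∣m+n (odd-edges-even i) 2∣N))
    ... | inj₁ 2∣d = even-rotation-weight i r p d (quotient ℓ∣dr) 2∣d N≡dp shift-p (m∣n⇒n≡quotient*m ℓ∣dr)
      where
      -- Translating d times by p is translation by N, the identity; as the vertices are distinct,
      -- the total rotation by d r places is trivial too.
      ℓ∣dr : ℓ ∣ d * r
      ℓ∣dr = cong0⇒∣ (cong-trans (cong-refl (sym (+-identityʳ (d * r)))) (cong-sym (distinct i
        (cong⇒≡ (bounded i 0) (bounded i _) (cong-trans (iterate-shift {i} shift-p d 0)
          (cong-+N (divides 1 (trans (sym N≡dp) (sym (*-identityˡ N))))))))))

    orbit-weight : ∀ i p → p ∣ N → iter next p i ≡ i → 2 ^ suc e ∣ p * (odd-edges i + N)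
    orbit-weight i p (divides d N≡dp) fix with subst (Translate p i) fix (Translate-iter p i)
    ... | r , _ , inj₁ refl , sh = rotation-weight i r p d N≡dp
      λ k → cong-trans (sh k) (cong-refl (cong (λ z → c i (r + z) + p) (*-identityˡ k)))
    ... | r , ε , inj₂ ε+1≡ℓ , sh = ⊥-elim (no-reflection {i} {r} {ε} {p} ε+1≡ℓ sh)

-- Parity and size of the family

module FamilyCount (m h ℓ s : ℕ) .{{_ : NonZero m}} .{{_ : NonZero h}} (3≤ℓ : 3 ≤ ℓ)
  (F : CyclicFamily m (2 * h) ℓ s) where

  open CyclicFamily F
  open FamilyParity m h ℓ s 3≤ℓ F

  weight-sum : ∀ e → 2 ^ e ∣ N →
               2 ^ suc e ∣ sum (map (λ i → odd-edges i + N) (allFin s))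
  weight-sum e 2^e∣N =
    M∣sum (length (allFin s)) (allFin s) ≤-refl (Unique.allFin⁺ s) (λ _ → ∈-allFin _)
    where
    N′ = pred N
    N≡suc : suc N′ ≡ N
    N≡suc = suc-pred N {{>-nonZero 0<N}}
    open OrbitSum Fin._≟_ next N′ (λ i → trans (cong (λ z → iter next z i) N≡suc) (next-order i))
      (λ i → odd-edges i + N) (λ i → cong (_+ N) (odd-edges-next i)) (2 ^ suc e)
      (λ i p p∣N fix → orbit-weight e 2^e∣N i p (subst (p ∣_) N≡suc p∣N) fix)

  -- Double counting by `edge-sum`; the factor `χ` makes the weight vanish off the edges and is 1 on
  -- them.
  sum-odd-edges : sum (map odd-edges (allFin s)) ≡ N * (h * (m / 2))
  sum-odd-edges = *-cancelˡ-≡ _ _ 2 (begin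
    2 * sum (map odd-edges (allFin s))
      ≡⟨ cong (λ z → 2 * sum z) (map-cong (λ i → ∑-cong ℓ λ k _ → sym (on-edge i k)) (allFin s)) ⟩
    2 * sum (map (λ i → ∑ ℓ λ k → f (c i k) (c i (suc k))) (allFin s))
      ≡⟨ edge-sum f (λ x y → cong₂ _*_ (χ-sym m x y) (cong par (+-comm x y)))
           (λ x y ¬adj → cong (_* par (x + y)) (χ-¬Adj m x y ¬adj)) ⟩
    ∑ N (λ x → ∑ N (f x))            ≡⟨ ∑-cong N (λ x _ → ∑-χpar m h x) ⟩
    ∑ N (λ _ → 2 * (h * (m / 2)))    ≡⟨ ∑-const N _ ⟩
    N * (2 * (h * (m / 2)))          ≡⟨ lem N (h * (m / 2)) ⟩
    2 * (N * (h * (m / 2)))          ∎)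
    where
    f : ℕ → ℕ → ℕ
    f x y = χ m x y * par (x + y)
    on-edge : ∀ i k → f (c i k) (c i (suc k)) ≡ bit i k
    on-edge i k = trans (cong (_* bit i k) (χ-Adj m _ _ (adjacent i k))) (*-identityˡ (bit i k))
    lem : ∀ a b → a * (2 * b) ≡ 2 * (a * b)
    lem a b = solve (a ∷ b ∷ [])

  -- With N = 2^e q and q odd, the weights add up to 2^e q (P + s). Divisibility by 2^(e+1) leaves 2
  -- dividing q (P + s), and q cancels.
  family-parity : 2 ∣ h * (m / 2) + s
  family-parity with 2-adic N N ≤-refl 0<N
  ... | e , q , odd-q , N≡ = 2∣odd*⇒2∣ odd-q (*-cancelˡ-∣ (2 ^ e) {{m^n≢0 2 e}}
      (subst₂ _∣_ (*-comm 2 (2 ^ e)) total (weight-sum e (divides q (trans N≡ (*-comm (2 ^ e) q))))))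
    where
    P = h * (m / 2)
    total : sum (map (λ i → odd-edges i + N) (allFin s)) ≡ 2 ^ e * (q * (P + s))
    total = begin
      sum (map (λ i → odd-edges i + N) (allFin s))    ≡⟨ sum-+ odd-edges (λ _ → N) (allFin s) ⟩
      sum (map odd-edges (allFin s)) + sum (map (λ _ → N) (allFin s))
        ≡⟨ cong₂ _+_ sum-odd-edges (trans (sum-const N (allFin s)) (cong (_* N) (length-tabulate {n = s} id))) ⟩
      N * P + s * N          ≡⟨ cong (N * P +_) (*-comm s N) ⟩
      N * P + N * s          ≡⟨ *-distribˡ-+ N P s ⟨
      N * (P + s)            ≡⟨ cong (_* (P + s)) N≡ ⟩
      2 ^ e * q * (P + s)    ≡⟨ *-assoc (2 ^ e) q (P + s) ⟩
      2 ^ e * (q * (P + s))  ∎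

  -- Double counting with weight `χ`: each vertex has N - 2h neighbours. The part sizes are kept on
  -- the left to avoid subtraction.
  family-size : 2 * (s * ℓ) + N * (2 * h) ≡ N * N
  family-size = begin
    2 * (s * ℓ) + N * (2 * h)
      ≡⟨ cong (λ z → 2 * z + N * (2 * h)) (trans (cong (_* ℓ) (sym (length-tabulate {n = s} id))) (sym (sum-const ℓ (allFin s)))) ⟩
    2 * sum (map (λ _ → ℓ) (allFin s)) + N * (2 * h)
      ≡⟨ cong (λ z → 2 * sum z + N * (2 * h)) (map-cong on-edges (allFin s)) ⟩
    2 * sum (map (λ i → ∑ ℓ λ k → χ m (c i k) (c i (suc k))) (allFin s)) + N * (2 * h)
      ≡⟨ cong (_+ N * (2 * h)) (edge-sum (χ m) (χ-sym m) (χ-¬Adj m)) ⟩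
    ∑ N (λ x → ∑ N (χ m x)) + N * (2 * h)                ≡⟨ cong (∑ N (λ x → ∑ N (χ m x)) +_) (∑-const N (2 * h)) ⟨
    ∑ N (λ x → ∑ N (χ m x)) + ∑ N (λ _ → 2 * h)          ≡⟨ ∑-+ N (λ x → ∑ N (χ m x)) (λ _ → 2 * h) ⟨
    ∑ N (λ x → ∑ N (χ m x) + 2 * h)                      ≡⟨ ∑-cong N (λ x _ → ∑-χ m h x) ⟩
    ∑ N (λ _ → N)                                          ≡⟨ ∑-const N N ⟩
    N * N                                                  ∎
    where
    on-edges : ∀ i → ℓ ≡ ∑ ℓ (λ k → χ m (c i k) (c i (suc k)))
    on-edges i = sym (trans (∑-cong ℓ λ k _ → χ-Adj m _ _ (adjacent i k)) (trans (∑-const ℓ 1) (*-identityʳ ℓ)))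

-- Vertex lists read as periodic sequences

-- The default 0 past the end lets `nth-drop` and `nth-take` hold without a bound by the length.
nth : List ℕ → ℕ → ℕ
nth []       _       = 0
nth (x ∷ xs) zero    = x
nth (x ∷ xs) (suc i) = nth xs i

nth-++ˡ : ∀ xs ys i → i < length xs → nth (xs ++ ys) i ≡ nth xs i
nth-++ˡ (x ∷ xs) ys zero    _         = refl
nth-++ˡ (x ∷ xs) ys (suc i) (s<s i<n) = nth-++ˡ xs ys i i<n

nth-++ʳ : ∀ xs ys j → nth (xs ++ ys) (length xs + j) ≡ nth ys j
nth-++ʳ []       ys j = refl
nth-++ʳ (x ∷ xs) ys j = nth-++ʳ xs ys j

nth-drop : ∀ k xs i → nth (drop k xs) i ≡ nth xs (k + i)
nth-drop zero    xs       i = refl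
nth-drop (suc k) []       i = refl
nth-drop (suc k) (x ∷ xs) i = nth-drop k xs i

nth-take : ∀ k xs i → i < k → nth (take k xs) i ≡ nth xs i
nth-take (suc k) []       i       _         = refl
nth-take (suc k) (x ∷ xs) zero    _         = refl
nth-take (suc k) (x ∷ xs) (suc i) (s<s i<k) = nth-take k xs i i<k

nth-map : ∀ (f : ℕ → ℕ) xs i → i < length xs → nth (map f xs) i ≡ f (nth xs i)
nth-map f (x ∷ xs) zero    _         = refl
nth-map f (x ∷ xs) (suc i) (s<s i<n) = nth-map f xs i i<n

nth-reverse : ∀ xs i j → suc (i + j) ≡ length xs → nth (reverse xs) i ≡ nth xs j
nth-reverse (x ∷ xs) i zero    eq = begin
  nth (reverse (x ∷ xs)) i                            ≡⟨ cong (λ z → nth z i) (unfold-reverse x xs) ⟩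
  nth (reverse xs ++ x ∷ []) i                        ≡⟨ cong (nth (reverse xs ++ x ∷ [])) i≡ ⟩
  nth (reverse xs ++ x ∷ []) (length (reverse xs) + 0) ≡⟨ nth-++ʳ (reverse xs) (x ∷ []) 0 ⟩
  x                                                   ∎
  where
  i≡ : i ≡ length (reverse xs) + 0
  i≡ = trans (sym (+-identityʳ i)) (trans (suc-injective eq)
    (trans (sym (length-reverse xs)) (sym (+-identityʳ _))))
nth-reverse (x ∷ xs) i (suc j) eq = begin
  nth (reverse (x ∷ xs)) i        ≡⟨ cong (λ z → nth z i) (unfold-reverse x xs) ⟩
  nth (reverse xs ++ x ∷ []) i    ≡⟨ nth-++ˡ (reverse xs) (x ∷ []) i i< ⟩
  nth (reverse xs) i              ≡⟨ nth-reverse xs i j eq′ ⟩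
  nth xs j                        ∎
  where
  eq′ : suc (i + j) ≡ length xs
  eq′ = trans (sym (+-suc i j)) (suc-injective eq)
  i< : i < length (reverse xs)
  i< = subst (i <_) (trans eq′ (sym (length-reverse xs))) (s≤s (m≤m+n i j))

All-nth : ∀ {P : ℕ → Set} {xs} → All P xs → ∀ i → i < length xs → P (nth xs i)
All-nth (p All.∷ ps) zero    _         = p
All-nth (p All.∷ ps) (suc i) (s<s i<n) = All-nth ps i i<n

nth-injective : ∀ {xs} → Unique xs → ∀ i j → i < length xs → j < length xs →
                nth xs i ≡ nth xs j → i ≡ j
nth-injective (x∉ AllPairs.∷ u) zero    zero    _         _         e = refl
nth-injective (x∉ AllPairs.∷ u) zero    (suc j) _         (s<s j<n) e = ⊥-elim (All-nth x∉ j j<n e)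
nth-injective (x∉ AllPairs.∷ u) (suc i) zero    (s<s i<n) _         e = ⊥-elim (All-nth x∉ i i<n (sym e))
nth-injective (x∉ AllPairs.∷ u) (suc i) (suc j) (s<s i<n) (s<s j<n) e = cong suc (nth-injective u i j i<n j<n e)

applyUpTo-nth : ∀ xs → xs ≡ applyUpTo (nth xs) (length xs)
applyUpTo-nth []       = refl
applyUpTo-nth (x ∷ xs) = cong (x ∷_) (applyUpTo-nth xs)

applyUpTo-cong : ∀ {A : Set} n {f g : ℕ → A} → (∀ k → k < n → f k ≡ g k) → applyUpTo f n ≡ applyUpTo g n
applyUpTo-cong zero    e = refl
applyUpTo-cong (suc n) e = cong₂ _∷_ (e 0 z<s) (applyUpTo-cong n λ k k<n → e (suc k) (s<s k<n))

zip-applyUpTo : ∀ n (f g : ℕ → ℕ) → zip (applyUpTo f n) (applyUpTo g n) ≡ applyUpTo (λ k → f k , g k) n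
zip-applyUpTo zero    f g = refl
zip-applyUpTo (suc n) f g = cong ((f 0 , g 0) ∷_) (zip-applyUpTo n (f ∘ suc) (g ∘ suc))

sum-applyUpTo : ∀ {A : Set} n (f : A → ℕ) (g : ℕ → A) → sum (map f (applyUpTo g n)) ≡ ∑ n (f ∘ g)
sum-applyUpTo zero    f g = refl
sum-applyUpTo (suc n) f g = cong (f (g 0) +_) (sum-applyUpTo n f (g ∘ suc))

length-rotate : ∀ k (c : List ℕ) → length (rotate k c) ≡ length c
length-rotate k c = begin
  length (drop k c ++ take k c)           ≡⟨ length-++ (drop k c) ⟩
  length (drop k c) + length (take k c)   ≡⟨ cong₂ _+_ (length-drop k c) (length-take k c) ⟩
  (length c ∸ k) + (k ⊓ length c)         ≡⟨ +-comm (length c ∸ k) _ ⟩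
  (k ⊓ length c) + (length c ∸ k)         ≡⟨ m⊓n+n∸m≡n k (length c) ⟩
  length c                                ∎

succMod-cong : ∀ N x → Cong N (succMod N x) (x + 1)
succMod-cong N x with suc x ≡ᵇ N in eq
... | false = cong-refl (+-comm 1 x)
... | true  = offset 1 0 (trans (+-identityʳ N)
  (trans (sym (≡ᵇ⇒≡ (suc x) N (subst T (sym eq) _))) (trans (+-comm 1 x) (sym (+-identityʳ _)))))

module Cyclic (ℓ : ℕ) .{{_ : NonZero ℓ}} where

  cyc : List ℕ → ℕ → ℕ
  cyc c k = nth c (k % ℓ)

  cyc-cong : ∀ c {k k′} → Cong ℓ k k′ → cyc c k ≡ cyc c k′
  cyc-cong c e = cong (nth c) (cong⇒% e)

  cyc-< : ∀ c {k} → k < ℓ → cyc c k ≡ nth c k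
  cyc-< c k<ℓ = cong (nth c) (m<n⇒m%n≡m k<ℓ)

  nth-rotate : ∀ k c → length c ≡ ℓ → k ≤ ℓ → ∀ i → i < ℓ → nth (rotate k c) i ≡ cyc c (k + i)
  nth-rotate k c len k≤ℓ i i<ℓ with i <? ℓ ∸ k
  ... | yes i<ℓ∸k = begin
    nth (drop k c ++ take k c) i  ≡⟨ nth-++ˡ (drop k c) (take k c) i (subst (i <_) (sym drop-len) i<ℓ∸k) ⟩
    nth (drop k c) i              ≡⟨ nth-drop k c i ⟩
    nth c (k + i)                 ≡⟨ cyc-< c k+i<ℓ ⟨
    cyc c (k + i)                 ∎
    where
    drop-len : length (drop k c) ≡ ℓ ∸ k
    drop-len = trans (length-drop k c) (cong (_∸ k) len)
    k+i<ℓ : k + i < ℓ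
    k+i<ℓ = subst (k + i <_) (m+[n∸m]≡n k≤ℓ) (+-monoʳ-< k i<ℓ∸k)
  -- The index has run past the end of the list: k + i = ℓ + j, with `j` in the prefix that was
  -- moved to the back.
  ... | no i≮ = begin
    nth (drop k c ++ take k c) i                        ≡⟨ cong (nth (rotate k c)) i≡ ⟩
    nth (drop k c ++ take k c) (length (drop k c) + j)  ≡⟨ nth-++ʳ (drop k c) (take k c) j ⟩
    nth (take k c) j                                    ≡⟨ nth-take k c j j<k ⟩
    nth c j                                             ≡⟨ cyc-< c (<-≤-trans j<k k≤ℓ) ⟨
    cyc c j                                             ≡⟨ cyc-cong c (offset 1 0 wrap) ⟩
    cyc c (k + i)                                       ∎
    where
    j = i ∸ (ℓ ∸ k)
    i≡′ : (ℓ ∸ k) + j ≡ i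
    i≡′ = m+[n∸m]≡n (≮⇒≥ i≮)
    i≡ : i ≡ length (drop k c) + j
    i≡ = trans (sym i≡′) (cong (_+ j) (sym (trans (length-drop k c) (cong (_∸ k) len))))
    ℓ+j≡k+i : ℓ + j ≡ k + i
    ℓ+j≡k+i = trans (cong (_+ j) (sym (m+[n∸m]≡n k≤ℓ))) (trans (+-assoc k (ℓ ∸ k) j) (cong (k +_) i≡′))
    j<k : j < k
    j<k = +-cancelˡ-< ℓ j k (subst₂ _<_ (sym ℓ+j≡k+i) (+-comm k ℓ) (+-monoʳ-< k i<ℓ))
    wrap : j + 1 * ℓ ≡ k + i + 0
    wrap = trans (cong (j +_) (+-identityʳ ℓ)) (trans (+-comm j ℓ) (trans ℓ+j≡k+i (sym (+-identityʳ _))))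

  cyc-rotate : ∀ k c → length c ≡ ℓ → ∃ λ r → ∀ x → cyc (rotate k c) x ≡ cyc c (r + x)
  cyc-rotate k c len with ≤-total k ℓ
  ... | inj₁ k≤ℓ = k , λ x → trans (nth-rotate k c len k≤ℓ (x % ℓ) (m%n<n x ℓ))
    (cyc-cong c (cong-+ {a = k} (cong-refl refl) (cong-sym (%-cong x))))
  -- `SameCycle` does not bound `k`. From ℓ on, `rotate k` is the identity and not the rotation by k
  -- modulo ℓ, whence the offset 0.
  ... | inj₂ ℓ≤k = 0 , λ x → cong (λ z → cyc z x) (begin
    drop k c ++ take k c  ≡⟨ cong₂ _++_ (drop-all k c k≥) (take-all k c k≥) ⟩
    c                     ∎)
    where
    k≥ : k ≥ length c
    k≥ = subst (_≤ k) (sym len) ℓ≤k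

  -- Reversal sends position x to ℓ - 1 - x, which is -(x + 1) modulo ℓ.
  cyc-reverse : ∀ c ε → suc ε ≡ ℓ → length c ≡ ℓ → ∀ x → cyc (reverse c) x ≡ cyc c (ε * suc x)
  cyc-reverse c ε ε+1≡ℓ len x = begin
    nth (reverse c) i    ≡⟨ nth-reverse c i j (trans i+j (sym len)) ⟩
    nth c j              ≡⟨ cyc-< c j<ℓ ⟨
    cyc c j              ≡⟨ cyc-cong c (cong-sym (cong-trans (cong-* ε (cong-suc (%-cong x))) (reflect₁ 0 ε+1≡ℓ i j i+j))) ⟩
    cyc c (ε * suc x)    ∎
    where
    i = x % ℓ
    j = ε ∸ i
    i≤ε : i ≤ ε
    i≤ε = s≤s⁻¹ (subst (i <_) (sym ε+1≡ℓ) (m%n<n x ℓ))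
    i+j : suc (i + j) ≡ ℓ
    i+j = trans (cong suc (m+[n∸m]≡n i≤ε)) ε+1≡ℓ
    j<ℓ : j < ℓ
    j<ℓ = subst (j <_) ε+1≡ℓ (s≤s (m∸n≤m ε i))

  SameCycle⇒cyc : ∀ c d → length c ≡ ℓ → SameCycle c d →
                  ∃₂ λ r ε → (ε ≡ 1 ⊎ suc ε ≡ ℓ) × (∀ x → cyc d x ≡ cyc c (r + ε * x))
  SameCycle⇒cyc c _ len (k , inj₁ refl) with cyc-rotate k c len
  ... | r , e = r , 1 , inj₁ refl , λ x → trans (e x) (cong (λ z → cyc c (r + z)) (sym (*-identityˡ x)))
  SameCycle⇒cyc c _ len (k , inj₂ refl) with cyc-rotate k (reverse c) (trans (length-reverse c) len)
  ... | r , e = ε * suc r , ε , inj₂ ε+1≡ℓ , λ x → trans (e x) (trans (cyc-reverse c ε ε+1≡ℓ len (r + x))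
      (cong (cyc c) (*-distribˡ-+ ε (suc r) x)))
    where
    ε = pred ℓ
    ε+1≡ℓ : suc ε ≡ ℓ
    ε+1≡ℓ = suc-pred ℓ

  cyc-map : ∀ f c → length c ≡ ℓ → ∀ x → cyc (map f c) x ≡ f (cyc c x)
  cyc-map f c len x = nth-map f c (x % ℓ) (subst (x % ℓ <_) (sym len) (m%n<n x ℓ))

  edges-cyc : ∀ c → length c ≡ ℓ → edges c ≡ applyUpTo (λ k → cyc c k , cyc c (suc k)) ℓ
  edges-cyc c len = begin
    zip c (rotate 1 c)  ≡⟨ cong₂ zip lhs rhs ⟩
    zip (applyUpTo (cyc c) ℓ) (applyUpTo (cyc c ∘ suc) ℓ)  ≡⟨ zip-applyUpTo ℓ (cyc c) (cyc c ∘ suc) ⟩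
    applyUpTo (λ k → cyc c k , cyc c (suc k)) ℓ  ∎
    where
    lhs : c ≡ applyUpTo (cyc c) ℓ
    lhs = trans (applyUpTo-nth c) (trans (cong (applyUpTo (nth c)) len)
      (applyUpTo-cong ℓ λ k k<ℓ → sym (cyc-< c k<ℓ)))
    rhs : rotate 1 c ≡ applyUpTo (cyc c ∘ suc) ℓ
    rhs = trans (applyUpTo-nth (rotate 1 c)) (trans (cong (applyUpTo (nth (rotate 1 c))) (trans (length-rotate 1 c) len))
      (applyUpTo-cong ℓ λ k k<ℓ → nth-rotate 1 c len (>-nonZero⁻¹ ℓ) k k<ℓ))

-- Edge counts as sums over ordered pairs

⟦_⟧ : Bool → ℕ
⟦ b ⟧ = if b then 1 else 0

-- A disjunction becomes a sum only if the two alternatives exclude each other; a loop at x = y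
-- would satisfy both.
matches-δ : ∀ x y a b → a ≢ b → ⟦ matches x y (a , b) ⟧ ≡ δ a x * δ b y + δ b x * δ a y
matches-δ x y a b a≢b with a ≡ᵇ x in ax | b ≡ᵇ y in by | a ≡ᵇ y in ay | b ≡ᵇ x in bx
... | true  | true  | _     | true  = ⊥-elim (a≢b (trans (≡ᵇ⇒≡ a x (subst T (sym ax) _)) (sym (≡ᵇ⇒≡ b x (subst T (sym bx) _)))))
... | true  | true  | _     | false = refl
... | true  | false | true  | true  = refl
... | true  | false | true  | false = refl
... | true  | false | false | true  = refl
... | true  | false | false | false = refl
... | false | _     | true  | true  = refl
... | false | _     | true  | false = refl
... | false | _     | false | true  = refl
... | false | _     | false | false = refl

≡ᵇ-refl : ∀ x → (x ≡ᵇ x) ≡ true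
≡ᵇ-refl zero    = refl
≡ᵇ-refl (suc x) = ≡ᵇ-refl x

matches-refl : ∀ x y → matches x y (x , y) ≡ true
matches-refl x y rewrite ≡ᵇ-refl x | ≡ᵇ-refl y = refl

matches-flip : ∀ x y → matches x y (y , x) ≡ true
matches-flip x y rewrite ≡ᵇ-refl x | ≡ᵇ-refl y = ∨-zeroʳ ((y ≡ᵇ x) ∧ (x ≡ᵇ y))

countIn-≥1 : ∀ {x y e es} → e ∈ es → matches x y e ≡ true → 1 ≤ countIn x y es
countIn-≥1 {x} {y} {es = e ∷ es} (here refl) eq = ≤-trans (≤-reflexive (cong ⟦_⟧ (sym eq))) (m≤m+n _ (countIn x y es))
countIn-≥1 {x} {y} {es = e ∷ es} (there e∈) eq = ≤-trans (countIn-≥1 e∈ eq) (m≤n+m _ ⟦ matches x y e ⟧)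

term≤sum : ∀ {A : Set} (g : A → ℕ) xs i → g (lookup xs i) ≤ sum (map g xs)
term≤sum g (x ∷ xs) zero    = m≤m+n _ _
term≤sum g (x ∷ xs) (suc i) = ≤-trans (term≤sum g xs i) (m≤n+m _ (g x))

sum≤1⇒unique : ∀ {A : Set} (g : A → ℕ) xs {i j} → sum (map g xs) ≤ 1 →
               1 ≤ g (lookup xs i) → 1 ≤ g (lookup xs j) → i ≡ j
sum≤1⇒unique g (x ∷ xs) {zero}  {zero}  _  _  _  = refl
sum≤1⇒unique g (x ∷ xs) {zero}  {suc j} ≤1 gi gj =
  ⊥-elim (<⇒≱ (+-mono-≤ gi (≤-trans gj (term≤sum g xs j))) ≤1)
sum≤1⇒unique g (x ∷ xs) {suc i} {zero}  ≤1 gi gj =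
  ⊥-elim (<⇒≱ (+-mono-≤ gj (≤-trans gi (term≤sum g xs i))) ≤1)
sum≤1⇒unique g (x ∷ xs) {suc i} {suc j} ≤1 gi gj =
  cong suc (sum≤1⇒unique g xs (≤-trans (m≤n+m _ (g x)) ≤1) gi gj)

module EdgeSums (N : ℕ) (f : ℕ → ℕ → ℕ) (f-sym : ∀ x y → f x y ≡ f y x) where

  ∑∑ : (ℕ → ℕ → ℕ) → ℕ
  ∑∑ g = ∑ N λ x → ∑ N (g x)

  ∑∑-cong : ∀ {g h} → (∀ x y → x < N → y < N → g x y ≡ h x y) → ∑∑ g ≡ ∑∑ h
  ∑∑-cong e = ∑-cong N λ x x<N → ∑-cong N λ y y<N → e x y x<N y<N

  ∑∑-+ : ∀ g h → ∑∑ (λ x y → g x y + h x y) ≡ ∑∑ g + ∑∑ h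
  ∑∑-+ g h = trans (∑-cong N λ x _ → ∑-+ N (g x) (h x)) (∑-+ N (λ x → ∑ N (g x)) (λ x → ∑ N (h x)))

  ∑∑-0 : ∑∑ (λ _ _ → 0) ≡ 0
  ∑∑-0 = trans (∑-cong N λ _ _ → trans (∑-const N 0) (*-zeroʳ N)) (trans (∑-const N 0) (*-zeroʳ N))

  ∑∑-δδ : ∀ {a b} → a < N → b < N → ∑∑ (λ x y → δ a x * δ b y * f x y) ≡ f a b
  ∑∑-δδ {a} {b} a<N b<N = begin
    ∑∑ (λ x y → δ a x * δ b y * f x y)    ≡⟨ ∑∑-cong (λ x y _ _ → *-assoc (δ a x) (δ b y) (f x y)) ⟩
    ∑∑ (λ x y → δ a x * (δ b y * f x y))  ≡⟨ ∑-cong N (λ x _ → ∑-*ˡ N (δ a x) (λ y → δ b y * f x y)) ⟩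
    ∑ N (λ x → δ a x * ∑ N (λ y → δ b y * f x y))
      ≡⟨ ∑-cong N (λ x _ → cong (δ a x *_) (∑-δ N b (f x) b<N)) ⟩
    ∑ N (λ x → δ a x * f x b)             ≡⟨ ∑-δ N a (λ x → f x b) a<N ⟩
    f a b                                 ∎

  Proper : ℕ × ℕ → Set
  Proper (a , b) = a < N × b < N × a ≢ b

  f′ : ℕ × ℕ → ℕ
  f′ (a , b) = f a b

  ∑∑-matches : ∀ e → Proper e → ∑∑ (λ x y → ⟦ matches x y e ⟧ * f x y) ≡ 2 * f′ e
  ∑∑-matches (a , b) (a<N , b<N , a≢b) = begin
    ∑∑ (λ x y → ⟦ matches x y (a , b) ⟧ * f x y)
      ≡⟨ ∑∑-cong (λ x y _ _ → trans (cong (_* f x y) (matches-δ x y a b a≢b))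
                    (*-distribʳ-+ (f x y) (δ a x * δ b y) (δ b x * δ a y))) ⟩
    ∑∑ (λ x y → δ a x * δ b y * f x y + δ b x * δ a y * f x y)
      ≡⟨ ∑∑-+ (λ x y → δ a x * δ b y * f x y) (λ x y → δ b x * δ a y * f x y) ⟩
    ∑∑ (λ x y → δ a x * δ b y * f x y) + ∑∑ (λ x y → δ b x * δ a y * f x y)
      ≡⟨ cong₂ _+_ (∑∑-δδ a<N b<N) (∑∑-δδ b<N a<N) ⟩
    f a b + f b a        ≡⟨ cong (f a b +_) (trans (f-sym b a) (sym (+-identityʳ (f a b)))) ⟩
    2 * f a b            ∎

  ∑∑-countIn : ∀ es → All Proper es → ∑∑ (λ x y → countIn x y es * f x y) ≡ 2 * sum (map f′ es)
  ∑∑-countIn []       _        = ∑∑-0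
  ∑∑-countIn (e ∷ es) (p All.∷ ps) = begin
    ∑∑ (λ x y → (⟦ matches x y e ⟧ + countIn x y es) * f x y)
      ≡⟨ ∑∑-cong (λ x y _ _ → *-distribʳ-+ (f x y) ⟦ matches x y e ⟧ (countIn x y es)) ⟩
    ∑∑ (λ x y → ⟦ matches x y e ⟧ * f x y + countIn x y es * f x y)
      ≡⟨ ∑∑-+ (λ x y → ⟦ matches x y e ⟧ * f x y) (λ x y → countIn x y es * f x y) ⟩
    ∑∑ (λ x y → ⟦ matches x y e ⟧ * f x y) + ∑∑ (λ x y → countIn x y es * f x y)
      ≡⟨ cong₂ _+_ (∑∑-matches e p) (∑∑-countIn es ps) ⟩
    2 * f′ e + 2 * sum (map f′ es)
      ≡⟨ *-distribˡ-+ 2 (f′ e) (sum (map f′ es)) ⟨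
    2 * (f′ e + sum (map f′ es)) ∎

  ∑∑-edgeCount : ∀ S → All (λ c → All Proper (edges c)) S →
                 ∑∑ (λ x y → edgeCount x y S * f x y) ≡ 2 * sum (map (λ c → sum (map f′ (edges c))) S)
  ∑∑-edgeCount []      _        = ∑∑-0
  ∑∑-edgeCount (c ∷ S) (p All.∷ ps) = begin
    ∑∑ (λ x y → (countIn x y (edges c) + edgeCount x y S) * f x y)
      ≡⟨ ∑∑-cong (λ x y _ _ → *-distribʳ-+ (f x y) (countIn x y (edges c)) (edgeCount x y S)) ⟩
    ∑∑ (λ x y → countIn x y (edges c) * f x y + edgeCount x y S * f x y)
      ≡⟨ ∑∑-+ (λ x y → countIn x y (edges c) * f x y) (λ x y → edgeCount x y S * f x y) ⟩
    ∑∑ (λ x y → countIn x y (edges c) * f x y) + ∑∑ (λ x y → edgeCount x y S * f x y)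
      ≡⟨ cong₂ _+_ (∑∑-countIn (edges c) p) (∑∑-edgeCount S ps) ⟩
    2 * sum (map f′ (edges c)) + 2 * sum (map (λ c → sum (map f′ (edges c))) S)
      ≡⟨ *-distribˡ-+ 2 (sum (map f′ (edges c))) _ ⟨
    2 * sum (map (λ c → sum (map f′ (edges c))) (c ∷ S)) ∎

-- From a cyclic cycle system to a cyclic family

system⇒family : ∀ m n ℓ S → 3 ≤ ℓ → IsCyclicCycleSystem m n ℓ S → CyclicFamily m n ℓ (length S)
system⇒family m n ℓ S 3≤ℓ ((cycles , once) , shifts) = record
  { c = c ; periodic = λ i → cyc-cong (C i) ; distinct = distinct ; bounded = bounded
  ; adjacent = adjacent ; disjoint = disjoint ; disjoint′ = disjoint′
  ; next = next ; next-shift = next-shift ; edge-sum = edge-sum }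
  where
  instance
    ℓ≢0 : NonZero ℓ
    ℓ≢0 = >-nonZero (≤-trans (s≤s z≤n) 3≤ℓ)
  open Cyclic ℓ
  N = m * n
  C : Fin (length S) → List ℕ
  C = lookup S
  c : Fin (length S) → ℕ → ℕ
  c i = cyc (C i)
  cycle : ∀ i → IsCycle m n ℓ (C i)
  cycle i = All.lookup cycles (∈-lookup i)
  len : ∀ i → length (C i) ≡ ℓ
  len i = proj₁ (cycle i)
  index-< : ∀ i k → k % ℓ < length (C i)
  index-< i k = subst (k % ℓ <_) (sym (len i)) (m%n<n k ℓ)
  distinct : ∀ i {k k′} → c i k ≡ c i k′ → Cong ℓ k k′
  distinct i {k} {k′} e = %⇒cong (nth-injective (proj₁ (proj₂ (proj₂ (proj₂ (cycle i)))))
    (k % ℓ) (k′ % ℓ) (index-< i k) (index-< i k′) e)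
  bounded : ∀ i k → c i k < N
  bounded i k = All-nth (proj₁ (proj₂ (proj₂ (cycle i)))) (k % ℓ) (index-< i k)
  at-% : ∀ i k → (c i (k % ℓ) , c i (suc (k % ℓ))) ≡ (c i k , c i (suc k))
  at-% i k = cong₂ _,_ (cyc-cong (C i) (cong-sym (%-cong k))) (cyc-cong (C i) (cong-suc (cong-sym (%-cong k))))
  adjacent : ∀ i k → Adj m (c i k) (c i (suc k))
  adjacent i k = subst (λ e → Adj m (proj₁ e) (proj₂ e)) (at-% i k)
    (All.applyUpTo⁻ _ ℓ (subst (All _) (edges-cyc (C i) (len i)) (proj₂ (proj₂ (proj₂ (proj₂ (cycle i)))))) (m%n<n k ℓ))
  edge∈ : ∀ i k → (c i k , c i (suc k)) ∈ edges (C i)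
  edge∈ i k = subst₂ _∈_ (at-% i k) (sym (edges-cyc (C i) (len i)))
    (∈-applyUpTo⁺ (λ k → c i k , c i (suc k)) (m%n<n k ℓ))
  -- An edge count of 1 identifies indices and not just lists, so it also rules out that a cycle
  -- occurs twice in `S`.
  owner : ∀ {x y i j} → x < N → y < N → Adj m x y →
          1 ≤ countIn x y (edges (C i)) → 1 ≤ countIn x y (edges (C j)) → i ≡ j
  owner {x} {y} x<N y<N adj = sum≤1⇒unique (λ d → countIn x y (edges d)) S (≤-reflexive (once x y x<N y<N adj))
  disjoint : ∀ {i j k k′} → c i k ≡ c j k′ → c i (suc k) ≡ c j (suc k′) → i ≡ j
  disjoint {i} {j} {k} {k′} e e′ = owner (bounded i k) (bounded i (suc k)) (adjacent i k)
    (countIn-≥1 (edge∈ i k) (matches-refl (c i k) (c i (suc k))))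
    (subst₂ (λ x y → 1 ≤ countIn x y (edges (C j))) (sym e) (sym e′)
      (countIn-≥1 (edge∈ j k′) (matches-refl (c j k′) (c j (suc k′)))))
  disjoint′ : ∀ {i j k k′} → c i k ≡ c j (suc k′) → c i (suc k) ≡ c j k′ → i ≡ j
  disjoint′ {i} {j} {k} {k′} e e′ = owner (bounded i k) (bounded i (suc k)) (adjacent i k)
    (countIn-≥1 (edge∈ i k) (matches-refl (c i k) (c i (suc k))))
    (subst₂ (λ x y → 1 ≤ countIn x y (edges (C j))) (sym e) (sym e′)
      (countIn-≥1 (edge∈ j k′) (matches-flip (c j (suc k′)) (c j k′))))
  next : Fin (length S) → Fin (length S)
  next i = index (proj₁ (proj₂ (shifts (C i) (∈-lookup i))))
  next-shift : ∀ i → ∃₂ λ r ε → (ε ≡ 1 ⊎ suc ε ≡ ℓ) ×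
               (∀ k → Cong N (c (next i) k) (c i (r + ε * k) + 1))
  next-shift i with shifts (C i) (∈-lookup i)
  ... | d , d∈S , same with SameCycle⇒cyc (shift N (C i)) d (trans (length-map _ (C i)) (len i)) same
  ...   | r , ε , sgn , e = r , ε , sgn , λ k → cong-trans (cong-refl (begin
      cyc (lookup S (index d∈S)) k        ≡⟨ cong (λ z → cyc z k) (lookup-index d∈S) ⟨
      cyc d k                             ≡⟨ e k ⟩
      cyc (shift N (C i)) (r + ε * k)     ≡⟨ cyc-map (succMod N) (C i) (len i) (r + ε * k) ⟩
      succMod N (c i (r + ε * k))         ∎)) (succMod-cong N _)
  edge-sum : ∀ (f : ℕ → ℕ → ℕ) → (∀ x y → f x y ≡ f y x) → (∀ x y → ¬ Adj m x y → f x y ≡ 0) →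
             2 * sum (map (λ i → ∑ ℓ λ k → f (c i k) (c i (suc k))) (allFin (length S)))
             ≡ ∑ N λ x → ∑ N (f x)
  edge-sum f f-sym f-zero = begin
    2 * sum (map (λ i → ∑ ℓ λ k → f (c i k) (c i (suc k))) (allFin (length S)))
      ≡⟨ cong (λ z → 2 * sum z) by-index ⟩
    2 * sum (map (λ d → sum (map f′ (edges d))) S)
      ≡⟨ ∑∑-edgeCount S (All.tabulate proper) ⟨
    ∑∑ (λ x y → edgeCount x y S * f x y)
      ≡⟨ ∑∑-cong once-each ⟩
    ∑∑ f  ∎
    where
    open EdgeSums N f f-sym
    on-cycle : ∀ d → IsCycle m n ℓ d → ∑ ℓ (λ k → f (cyc d k) (cyc d (suc k))) ≡ sum (map f′ (edges d))
    on-cycle d cd = sym (trans (cong (λ z → sum (map f′ z)) (edges-cyc d (proj₁ cd)))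
      (sum-applyUpTo ℓ f′ (λ k → cyc d k , cyc d (suc k))))
    by-index : map (λ i → ∑ ℓ λ k → f (c i k) (c i (suc k))) (allFin (length S)) ≡
               map (λ d → sum (map f′ (edges d))) S
    by-index = begin
      map (λ i → ∑ ℓ λ k → f (c i k) (c i (suc k))) (allFin (length S))
        ≡⟨ map-cong (λ i → on-cycle (C i) (cycle i)) (allFin (length S)) ⟩
      map (λ i → sum (map f′ (edges (C i)))) (allFin (length S))
        ≡⟨ map-∘ (allFin (length S)) ⟩
      map (λ d → sum (map f′ (edges d))) (map C (allFin (length S)))
        ≡⟨ cong (map _) (trans (map-tabulate id C) (tabulate-lookup S)) ⟩
      map (λ d → sum (map f′ (edges d))) S ∎
    proper : ∀ {d} → d ∈ S → All Proper (edges d)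
    proper {d} d∈ = subst (All Proper) (sym (trans (cong edges (lookup-index d∈)) (edges-cyc (C i) (len i))))
      (All.applyUpTo⁺₂ _ ℓ λ k → bounded i k , bounded i (suc k) , λ e →
        adjacent i k (cong⇒∣∣-∣ _ _ (cong-refl e)))
      where i = index d∈
    once-each : ∀ x y → x < N → y < N → edgeCount x y S * f x y ≡ f x y
    once-each x y x<N y<N with m ∣? ∣ x - y ∣
    ... | no adj  = trans (cong (_* f x y) (once x y x<N y<N adj)) (*-identityˡ (f x y))
    -- `once` says nothing about the count at a non-adjacent pair; there the weight is 0.
    ... | yes m∣ rewrite f-zero x y (λ adj → adj m∣) = *-zeroʳ (edgeCount x y S)

-- 2-adic valuations and the four cases

Odd-* : ∀ {a b} → Odd a → Odd b → Odd (a * b)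
Odd-* (u , refl) (v , refl) = v + u * (1 + v * 2) , lem
  where
  lem : (1 + u * 2) * (1 + v * 2) ≡ 1 + (v + u * (1 + v * 2)) * 2
  lem = solve (u ∷ v ∷ [])

Odd⇒2∤ : ∀ {a} → Odd a → ¬ (2 ∣ a)
Odd⇒2∤ (v , refl) 2∣a = 1+n≢0 (suc-injective (∣1⇒≡1 (∣m+n∣m⇒∣n (subst (2 ∣_) (+-comm 1 (v * 2)) 2∣a) (n∣m*n v))))

Val2⇒odd-part : ∀ {x} e → Val2 x e → ∃ λ y → Odd y × x ≡ 2 ^ e * y
Val2⇒odd-part e (divides y eq , ¬d) with even⊎odd y
... | inj₂ odd = y , odd , trans eq (*-comm y (2 ^ e))
... | inj₁ (divides z refl) = ⊥-elim (¬d (divides z (trans eq (*-assoc z 2 (2 ^ e)))))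

r+t*4 : ∀ x {r} → x % 4 ≡ r → ∃ λ t → x ≡ r + t * 4
r+t*4 x refl = x / 4 , m≡m%n+[m/n]*n x 4

half : ∀ r t → (r + t * 4) / 2 ≡ r / 2 + t * 2
half r t = begin
  (r + t * 4) / 2          ≡⟨ cong (λ z → (r + z) / 2) (*-assoc t 2 2) ⟨
  (r + t * 2 * 2) / 2      ≡⟨ +-distrib-/-∣ʳ r (n∣m*n (t * 2)) ⟩
  r / 2 + t * 2 * 2 / 2    ≡⟨ cong (r / 2 +_) (m*n/n≡m (t * 2) 2) ⟩
  r / 2 + t * 2            ∎

system-size : ∀ m h ℓ → 2 ≤ m → 1 ≤ h → CyclicCycleSystemExists m (2 * h) ℓ →
  ∃ λ s → 2 ∣ h * (m / 2) + s × 2 * (s * ℓ) ≡ 2 * h * (2 * h) * (m * (m ∸ 1))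
-- The empty system misses the edge between 0 and 1. In the other clause the bound `3 ≤ ℓ` is read
-- off the first cycle.
system-size m h ℓ 2≤m 1≤h ([] , (_ , once) , _) =
  ⊥-elim (0≢1+n (once 0 1 (<-trans z<s 1<N) 1<N (λ m∣1 → <-irrefl (sym (∣1⇒≡1 m∣1)) 2≤m)))
  where
  1<N : 1 < m * (2 * h)
  1<N = *-mono-≤ {2} {m} {1} {2 * h} 2≤m (*-mono-≤ {1} {2} (s≤s z≤n) 1≤h)
system-size m@(suc m′) h ℓ _ 1≤h (S@(_ ∷ _) , sys) =
  s , family-parity , +-cancelʳ-≡ (N * (2 * h)) _ _ (trans family-size (lem m′))
  where
  s = length S
  N = m * (2 * h)
  3≤ℓ : 3 ≤ ℓ
  3≤ℓ = proj₁ (proj₂ (All.head (proj₁ (proj₁ sys))))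
  instance
    h≢0 : NonZero h
    h≢0 = >-nonZero 1≤h
  open FamilyCount m h ℓ s 3≤ℓ (system⇒family m (2 * h) ℓ S 3≤ℓ sys) using (family-parity; family-size)
  lem : ∀ m′ → (1 + m′) * (2 * h) * ((1 + m′) * (2 * h))
             ≡ 2 * h * (2 * h) * ((1 + m′) * m′) + (1 + m′) * (2 * h) * (2 * h)
  lem m′ = solve (m′ ∷ h ∷ [])

-- The number s of cycles is even, so 2sℓ is divisible by 2^(a+2), whereas m(m-1)(2h)² has valuation
-- exactly b + 2c = a + 1.
even-size-impossible : ∀ {m h ℓ o} a b c → 2 ≤ m → 1 ≤ h → 2 ∣ h * (m / 2) →
  m * (m ∸ 1) ≡ 2 ^ b * o → Odd o → Val2 ℓ a → Val2 (2 * h) c → suc a ≡ b + 2 * c →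
  ¬ CyclicCycleSystemExists m (2 * h) ℓ
even-size-impossible {m} {h} {ℓ} {o} a b c 2≤m 1≤h even m≡ odd-o (2^a∣ℓ , _) vn a≡ sys =
  contradict (system-size m h ℓ 2≤m 1≤h sys) (Val2⇒odd-part c vn)
  where
  K = b + 2 * c
  power : 2 * (2 * 2 ^ a) ≡ 2 ^ K * 2
  power = trans (cong (λ z → 2 * 2 ^ z) a≡) (*-comm 2 (2 ^ K))
  total : ∀ n′ → 2 * h ≡ 2 ^ c * n′ → 2 * h * (2 * h) * (m * (m ∸ 1)) ≡ 2 ^ K * (o * (n′ * n′))
  total n′ n≡ = begin
    2 * h * (2 * h) * (m * (m ∸ 1))               ≡⟨ cong₂ (λ u v → u * u * v) n≡ m≡ ⟩
    2 ^ c * n′ * (2 ^ c * n′) * (2 ^ b * o)       ≡⟨ lem (2 ^ c) (2 ^ b) ⟩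
    2 ^ b * (2 ^ c * (2 ^ c * 1)) * (o * (n′ * n′))
      ≡⟨ cong (λ z → 2 ^ b * z * (o * (n′ * n′))) (cong (2 ^ c *_) (*-identityʳ (2 ^ c))) ⟩
    2 ^ b * (2 ^ c * 2 ^ c) * (o * (n′ * n′))
      ≡⟨ cong (λ z → 2 ^ b * z * (o * (n′ * n′))) (trans (sym (^-distribˡ-+-* 2 c c)) (cong (λ z → 2 ^ (c + z)) (sym (+-identityʳ c)))) ⟩
    2 ^ b * 2 ^ (2 * c) * (o * (n′ * n′))         ≡⟨ cong (_* (o * (n′ * n′))) (^-distribˡ-+-* 2 b (2 * c)) ⟨
    2 ^ K * (o * (n′ * n′))                       ∎
    where
    lem : ∀ x y → x * n′ * (x * n′) * (y * o) ≡ y * (x * (x * 1)) * (o * (n′ * n′))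
    lem x y = solve (x ∷ y ∷ n′ ∷ o ∷ [])
  contradict : (∃ λ s → 2 ∣ h * (m / 2) + s × 2 * (s * ℓ) ≡ 2 * h * (2 * h) * (m * (m ∸ 1))) →
               (∃ λ n′ → Odd n′ × 2 * h ≡ 2 ^ c * n′) → ⊥
  contradict (s , even+s , size) (n′ , odd-n′ , n≡) = Odd⇒2∤ (Odd-* odd-o (Odd-* odd-n′ odd-n′))
    (*-cancelˡ-∣ (2 ^ K) {{m^n≢0 2 K}} (subst₂ _∣_ power (trans size (total n′ n≡))
      (*-monoʳ-∣ 2 (*-pres-∣ (∣m+n∣m⇒∣n even+s even) 2^a∣ℓ))))

-- The even one of m and m - 1 is 2 modulo 4, and its half is ⌊m/2⌋.
m%4∈23 : ∀ m → m % 4 ≡ 2 ⊎ m % 4 ≡ 3 → Odd (m / 2) × ∃ λ o → Odd o × m * (m ∸ 1) ≡ 2 ^ 1 * o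
m%4∈23 m (inj₁ e) with r+t*4 m e
... | t , refl = (t , half 2 t) , _ , Odd-* {1 + t * 2} {1 + t * 4} (t , refl) (t * 2 , lem₁) , lem₂
  where
  lem₁ : 1 + t * 4 ≡ 1 + t * 2 * 2
  lem₁ = solve (t ∷ [])
  lem₂ : (2 + t * 4) * (1 + t * 4) ≡ 2 * ((1 + t * 2) * (1 + t * 4))
  lem₂ = solve (t ∷ [])
m%4∈23 m (inj₂ e) with r+t*4 m e
... | t , refl = (t , half 3 t) , _ , Odd-* {3 + t * 4} {1 + t * 2} (1 + t * 2 , lem₁) (t , refl) , lem₂
  where
  lem₁ : 3 + t * 4 ≡ 1 + (1 + t * 2) * 2
  lem₁ = solve (t ∷ [])
  lem₂ : (3 + t * 4) * (2 + t * 4) ≡ 2 * ((3 + t * 4) * (1 + t * 2))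
  lem₂ = solve (t ∷ [])

2h%4≡0⇒even : ∀ h → 2 * h % 4 ≡ 0 → 2 ∣ h
2h%4≡0⇒even h e = divides t (*-cancelˡ-≡ h (t * 2) 2 (trans (proj₂ (r+t*4 (2 * h) e)) (lem t)))
  where
  t = proj₁ (r+t*4 (2 * h) e)
  lem : ∀ t → t * 4 ≡ 2 * (t * 2)
  lem t = solve (t ∷ [])

2h%4≡2⇒odd : ∀ h → 2 * h % 4 ≡ 2 → Odd h
2h%4≡2⇒odd h e = t , *-cancelˡ-≡ h (1 + t * 2) 2 (trans (proj₂ (r+t*4 (2 * h) e)) (lem t))
  where
  t = proj₁ (r+t*4 (2 * h) e)
  lem : ∀ t → 2 + t * 4 ≡ 2 * (1 + t * 2)
  lem t = solve (t ∷ [])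

1≤Val2 : ∀ {x} c → 2 ∣ x → Val2 x c → 1 ≤ c
1≤Val2 zero    2∣x (_ , ¬d) = ⊥-elim (¬d 2∣x)
1≤Val2 (suc c) _   _        = s≤s z≤n

-- The truncated subtraction is exact because n is even, that is, c ≥ 1.
suc[b+2c∸1] : ∀ b {c} → 1 ≤ c → suc (b + 2 * c ∸ 1) ≡ b + 2 * c
suc[b+2c∸1] b {suc c} _ = trans (cong (λ z → suc (z ∸ 1)) (+-suc b (c + suc (c + 0)))) (sym (+-suc b _))

theorem3p3 : (m n ℓ : ℕ) → 2 ≤ m → 1 ≤ n → 2 ∣ n →
    (m % 4 ≡ 0 → ∀ a b c → Val2 ℓ a → Val2 m b → Val2 n c → a ≡ b + 2 * c ∸ 1 →
    ¬ CyclicCycleSystemExists m n ℓ)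
    × (m % 4 ≡ 1 → ∀ a b c → Val2 ℓ a → Val2 (m ∸ 1) b → Val2 n c → a ≡ b + 2 * c ∸ 1 →
    ¬ CyclicCycleSystemExists m n ℓ)
    × ((m % 4 ≡ 2 ⊎ m % 4 ≡ 3) → n % 4 ≡ 2 → ¬ (4 ∣ ℓ) →
    ¬ CyclicCycleSystemExists m n ℓ)
    × ((m % 4 ≡ 2 ⊎ m % 4 ≡ 3) → n % 4 ≡ 0 → ∀ a c → Val2 ℓ a → Val2 n c → a ≡ 2 * c →
    ¬ CyclicCycleSystemExists m n ℓ)
theorem3p3 m n ℓ 2≤m 1≤n 2∣n@(divides h n≡h*2) with trans n≡h*2 (*-comm h 2)
... | refl = case-a , case-b , case-c , case-d
  where
  1≤h : 1 ≤ h
  1≤h = n≢0⇒n>0 λ { refl → <-irrefl refl 1≤n }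

  -- For m equal to 4t, and likewise 4t + 1 in `case-b`, ⌊m/2⌋ = 2t is even; the valuation of m(m-1)
  -- is that of its even factor.
  case-a : m % 4 ≡ 0 → ∀ a b c → Val2 ℓ a → Val2 m b → Val2 (2 * h) c → a ≡ b + 2 * c ∸ 1 →
           ¬ CyclicCycleSystemExists m (2 * h) ℓ
  case-a m%4 a b c vℓ vm vn a≡ with Val2⇒odd-part b vm | r+t*4 m m%4
  ... | m₁ , odd-m₁ , m≡ | t , m≡4t = even-size-impossible a b c 2≤m 1≤h
    (∣n⇒∣m*n h (divides t (trans (cong (_/ 2) m≡4t) (half 0 t))))
    (trans (cong (_* (m ∸ 1)) m≡) (*-assoc (2 ^ b) m₁ (m ∸ 1)))
    (Odd-* odd-m₁ (odd-pred m t 2≤m m≡4t)) vℓ vn (trans (cong suc a≡) (suc[b+2c∸1] b (1≤Val2 c 2∣n vn)))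
    where
    odd-pred : ∀ m t → 2 ≤ m → m ≡ t * 4 → Odd (m ∸ 1)
    odd-pred _ (suc t) _ refl = 1 + t * 2 , lem
      where
      lem : 3 + t * 4 ≡ 1 + (1 + t * 2) * 2
      lem = solve (t ∷ [])

  case-b : m % 4 ≡ 1 → ∀ a b c → Val2 ℓ a → Val2 (m ∸ 1) b → Val2 (2 * h) c → a ≡ b + 2 * c ∸ 1 →
           ¬ CyclicCycleSystemExists m (2 * h) ℓ
  case-b m%4 a b c vℓ vm vn a≡ with Val2⇒odd-part b vm | r+t*4 m m%4
  ... | m₁ , odd-m₁ , m-1≡ | t , m≡4t+1 = even-size-impossible a b c 2≤m 1≤h
    (∣n⇒∣m*n h (divides t (trans (cong (_/ 2) m≡4t+1) (half 1 t))))
    (trans (*-comm m (m ∸ 1)) (trans (cong (_* m) m-1≡) (*-assoc (2 ^ b) m₁ m)))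
    (Odd-* odd-m₁ (t * 2 , trans m≡4t+1 lem)) vℓ vn (trans (cong suc a≡) (suc[b+2c∸1] b (1≤Val2 c 2∣n vn)))
    where
    lem : 1 + t * 4 ≡ 1 + t * 2 * 2
    lem = solve (t ∷ [])

  -- Both h and ⌊m/2⌋ are odd, hence so is s; from sℓ = 4h²o the odd factor s is cancelled.
  case-c : m % 4 ≡ 2 ⊎ m % 4 ≡ 3 → 2 * h % 4 ≡ 2 → ¬ (4 ∣ ℓ) → ¬ CyclicCycleSystemExists m (2 * h) ℓ
  case-c m%4 n%4 4∤ℓ sys = 4∤ℓ (4∣ℓ (system-size m h ℓ 2≤m 1≤h sys) (m%4∈23 m m%4))
    where
    odd-h : Odd h
    odd-h = 2h%4≡2⇒odd h n%4
    odd-s : ∀ s → 2 ∣ h * (m / 2) + s → Odd (m / 2) → Odd s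
    odd-s s even odd-m/2 with even⊎odd s
    ... | inj₂ odd = odd
    ... | inj₁ 2∣s = ⊥-elim (Odd⇒2∤ (Odd-* odd-h odd-m/2)
      (∣m+n∣m⇒∣n (subst (2 ∣_) (+-comm (h * (m / 2)) s) even) 2∣s))
    lem : ∀ o → 2 * h * (2 * h) * (2 * o) ≡ 2 * (h * h * o * 4)
    lem o = solve (h ∷ o ∷ [])
    4∣ℓ : (∃ λ s → 2 ∣ h * (m / 2) + s × 2 * (s * ℓ) ≡ 2 * h * (2 * h) * (m * (m ∸ 1))) →
          Odd (m / 2) × (∃ λ o → Odd o × m * (m ∸ 1) ≡ 2 ^ 1 * o) → 4 ∣ ℓ
    4∣ℓ (s , even , size) (odd-m/2 , o , _ , m≡) = 2^∣odd*⇒2^∣ 2 (odd-s s even odd-m/2)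
      (divides (h * h * o) (*-cancelˡ-≡ (s * ℓ) (h * h * o * 4) 2
        (trans size (trans (cong (2 * h * (2 * h) *_) m≡) (lem o)))))

  case-d : m % 4 ≡ 2 ⊎ m % 4 ≡ 3 → 2 * h % 4 ≡ 0 → ∀ a c → Val2 ℓ a → Val2 (2 * h) c → a ≡ 2 * c →
           ¬ CyclicCycleSystemExists m (2 * h) ℓ
  case-d m%4 n%4 a c vℓ vn a≡ with m%4∈23 m m%4
  -- Here evenness of h⌊m/2⌋ comes from h, and the valuation of m(m-1) is 1.
  ... | _ , o , odd-o , m≡ = even-size-impossible a 1 c 2≤m 1≤h
    (∣m⇒∣m*n (m / 2) (2h%4≡0⇒even h n%4)) m≡ odd-o vℓ vn (cong suc a≡)
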